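{- Let $\Delta$ be a positive integer, and let $S = \{x \in \mathbb{R}^n : Ax \leq b\}$ be a full-dimensional simplex with $A \in \mathbb{Z}^{(n+1)\times n}$, $b \in \mathbb{Z}^{n+1}$, $\Delta_A \leq \Delta$, and smallest facet width greater than or equal to $\Delta - 1$. For $i = 1,\ldots,n+1$, let $A_i x \leq b^{(i)}$ be the system obtained by deleting the $i$-th inequality from $Ax \leq b$, let $u_i := A_i^{ -1} b^{(i)}$, let $a'_{i,1},\ldots,a'_{i,n}$ be the columns of $A_i^{ -1}$, and let $S_i$ be the convex hull of $\{u_i,\, u_i - (\Delta-1)a'_{i,1}, \ldots, u_i - (\Delta-1)a'_{i,n}\}$. Let $V := \bigcup_{i=1}^{n+1} (S_i \cap \mathbb{Z}^n)$. Then $V$ contains all vertices of the convex hull of $S \cap \mathbb{Z}^n$.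
   Context: For $A \in \mathbb{Z}^{m\times n}$, $\Delta_A$ denotes the maximum absolute value of any $n\times n$ subdeterminant of $A$. For a set $S \subseteq \mathbb{R}^n$ and $v \in \mathbb{R}^n$, the width of $S$ in direction $v$ is $w(v,S) := \max_{x\in S} v\cdot x - \min_{x \in S} v \cdot x$; for a row $v$ of $A$ defining a facet of $S$, $w(v,S)$ is the corresponding facet width. (In the paper, $V$ is the output of an algorithm computing exactly this set.) -}

module Defs where

open import Data.Nat as ℕ using (ℕ; zero; suc)
open import Data.Integer as ℤ using (ℤ; +_)
open import Data.Rational as ℚ using (ℚ; 0ℚ; 1ℚ; _/_)
open import Data.Fin using (Fin; zero; suc; punchIn)
open import Data.Product using (Σ; _×_; ∃)
open import Relation.Binary.PropositionalEquality using (_≡_)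
open import Function.Definitions using (Injective)

ℚVec : ℕ → Set
ℚVec n = Fin n → ℚ

ℤVec : ℕ → Set
ℤVec n = Fin n → ℤ

ι : ℤ → ℚ
ι z = z / 1

ιv : ∀ {n} → ℤVec n → ℚVec n
ιv z k = ι (z k)

sumℚ : ∀ {n} → (Fin n → ℚ) → ℚ
sumℚ {zero}  f = 0ℚ
sumℚ {suc n} f = f zero ℚ.+ sumℚ (λ k → f (suc k))

sumℤ : ∀ {n} → (Fin n → ℤ) → ℤ
sumℤ {zero}  f = + 0
sumℤ {suc n} f = f zero ℤ.+ sumℤ (λ k → f (suc k))

dot : ∀ {n} → ℤVec n → ℚVec n → ℚ
dot a x = sumℚ (λ k → ι (a k) ℚ.* x k)

sgn : ∀ {n} → Fin n → ℤ
sgn zero    = + 1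
sgn (suc j) = ℤ.- sgn j

det : ∀ {n} → (Fin n → Fin n → ℤ) → ℤ
det {zero}  M = + 1
det {suc n} M = sumℤ (λ j → sgn j ℤ.* (M zero j ℤ.* det (λ r c → M (suc r) (punchIn j c))))

SubdetBound : ∀ {m n} → (Fin m → Fin n → ℤ) → ℕ → Set
SubdetBound {m} {n} A Δ =
  (σ : Fin n → Fin m) → Injective _≡_ _≡_ σ →
  ℤ.∣ det (λ r c → A (σ r) c) ∣ ℕ.≤ Δ

InPoly : ∀ {m n} → (Fin m → Fin n → ℤ) → (Fin m → ℤ) → ℚVec n → Set
InPoly A b x = ∀ j → dot (A j) x ℚ.≤ ι (b j)

FullDim : ∀ {m n} → (Fin m → Fin n → ℤ) → (Fin m → ℤ) → Set
FullDim {n = n} A b = Σ (ℚVec n) λ x → ∀ j → dot (A j) x ℚ.< ι (b j)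

Bounded : ∀ {m n} → (Fin m → Fin n → ℤ) → (Fin m → ℤ) → Set
Bounded {n = n} A b = Σ ℚ λ M → (x : ℚVec n) → InPoly A b x →
  ∀ k → (ℚ.- M ℚ.≤ x k) × (x k ℚ.≤ M)

-- a full-dimensional simplex in ℝ^n given by n+1 inequalities:
-- a bounded polyhedron with nonempty interior described by n+1 inequalities
FullDimSimplex : ∀ {n} → (Fin (suc n) → Fin n → ℤ) → (Fin (suc n) → ℤ) → Set
FullDimSimplex A b = FullDim A b × Bounded A b

-- w(v,S) ≥ c  (max minus min of v·x over the compact set S is ≥ c)
WidthAtLeast : ∀ {m n} → (Fin m → Fin n → ℤ) → (Fin m → ℤ) → ℤVec n → ℚ → Set
WidthAtLeast {n = n} A b v c =
  Σ (ℚVec n) λ x → Σ (ℚVec n) λ y →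
    InPoly A b x × InPoly A b y × (c ℚ.≤ dot v x ℚ.- dot v y)

MinFacetWidthAtLeast : ∀ {m n} → (Fin m → Fin n → ℤ) → (Fin m → ℤ) → ℚ → Set
MinFacetWidthAtLeast A b c = ∀ j → WidthAtLeast A b (A j) c

delRow : ∀ {n} {X : Set} → Fin (suc n) → (Fin (suc n) → X) → Fin n → X
delRow i f r = f (punchIn i r)

δ : ∀ {n} → Fin n → Fin n → ℚ
δ zero    zero    = 1ℚ
δ zero    (suc _) = 0ℚ
δ (suc _) zero    = 0ℚ
δ (suc r) (suc c) = δ r c

IsInverse : ∀ {n} → (Fin n → Fin n → ℤ) → (Fin n → Fin n → ℚ) → Set
IsInverse {n} M B = ∀ r c → sumℚ (λ k → ι (M r k) ℚ.* B k c) ≡ δ r c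

mulMV : ∀ {n} → (Fin n → Fin n → ℚ) → ℤVec n → ℚVec n
mulMV B y k = sumℚ (λ r → B k r ℚ.* ι (y r))

InConv : ∀ {k n} → (Fin k → ℚVec n) → ℚVec n → Set
InConv {k} p x = Σ (Fin k → ℚ) λ λs →
  (∀ t → 0ℚ ℚ.≤ λs t) × (sumℚ λs ≡ 1ℚ) ×
  (∀ c → x c ≡ sumℚ (λ t → λs t ℚ.* p t c))

InIntHull : ∀ {n} → (Fin (suc n) → Fin n → ℤ) → (Fin (suc n) → ℤ) → ℚVec n → Set
InIntHull {n} A b x = Σ ℕ λ k → Σ (Fin k → ℤVec n) λ z →
  (∀ t → InPoly A b (ιv (z t))) × InConv (λ t → ιv (z t)) x

IsVertex : ∀ {n} → (ℚVec n → Set) → ℚVec n → Set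
IsVertex {n} P v = P v × ((y w : ℚVec n) (t : ℚ) → P y → P w →
  0ℚ ℚ.< t → t ℚ.< 1ℚ →
  (∀ c → v c ≡ t ℚ.* y c ℚ.+ (1ℚ ℚ.- t) ℚ.* w c) →
  (∀ c → y c ≡ v c) × (∀ c → w c ≡ v c))

-- S_i = conv{u_i, u_i - (Δ-1) a'_{i,1}, ..., u_i - (Δ-1) a'_{i,n}},
-- where u_i = B b^(i) and a'_{i,j} is the j-th column of B = A_i^{-1}
SiPoints : ∀ {n} → ℕ → (Fin n → Fin n → ℚ) → ℤVec n → Fin (suc n) → ℚVec n
SiPoints Δ B bi zero    k = mulMV B bi k
SiPoints Δ B bi (suc j) k = mulMV B bi k ℚ.- ι (+ (Δ ℕ.∸ 1)) ℚ.* B k j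

InV : ∀ {n} → ℕ → (Fin (suc n) → ℤ) → (Fin (suc n) → Fin n → Fin n → ℚ) → ℤVec n → Set
InV {n} Δ b Ainv z = Σ (Fin (suc n)) λ i → InConv (SiPoints Δ (Ainv i) (delRow i b)) (ιv z)

{-# OPTIONS --safe #-}

-- Write s for the slack vector of an integral point z of S. The coordinates of
-- u_i - z with respect to the columns of A_i⁻¹ are the slacks in the rows
-- other than i, so z lies in S_i as soon as these slacks sum to at most Δ - 1.
--
-- Suppose they sum to at least Δ for every i. The lattice A_i ℤⁿ has index
-- |det A_i| ≤ Δ, so among the Δ + 1 members of a chain of multisets below the
-- slacks two are congruent modulo it, and their difference gives w_i ≠ 0 in ℤⁿ
-- with 0 ≤ A_i w_i ≤ (the slacks other than s_i). As S is bounded, row i is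
-- negative on w_i, so z + w_i lies in S. The matrix of all products A_j · w_i
-- is nonnegative off the diagonal, so elimination gives weights p ≥ 0, p ≠ 0,
-- for which x = Σ p_i w_i satisfies A x ≥ 0 or A x ≤ 0. Boundedness forces x = 0:
-- z is a convex combination of the points z + w_i of S, and not a vertex.
module Submission where

open import Defs
open import Algebra.Structures using (IsCommutativeRing)
open import Data.Fin as Fin using (Fin; zero; suc; punchIn; punchOut; toℕ; fromℕ; fromℕ<; inject₁; combine)
import Data.Fin.Induction as Fin
import Data.Fin.Properties as Fin
open import Data.Integer as ℤ using (ℤ; +_; 0ℤ; 1ℤ; -1ℤ; ∣_∣)
import Data.Integer.DivMod as ℤ
import Data.Integer.Properties as ℤ
import Data.Integer.Tactic.RingSolver as ℤ-Ring
open import Data.Nat as ℕ using (ℕ; zero; suc; z≤n; s≤s; _≤_; _∸_)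
open import Data.Nat.Induction using (Acc; acc; <-wellFounded)
import Data.Nat.Properties as ℕ
open import Data.Product using (Σ; ∃; ∃₂; _×_; _,_; proj₁; proj₂)
open import Data.Rational as ℚ using (ℚ; 0ℚ; 1ℚ; ½; ↥_; ↧_; toℚᵘ)
import Data.Rational.Properties as ℚ
open import Data.Rational.Unnormalised as ℚᵘ using (mkℚᵘ; *≡*)
import Data.Rational.Unnormalised.Properties as ℚᵘ
open import Data.Sum using (_⊎_; inj₁; inj₂; swap; [_,_]′)
open import Data.Vec.Functional using (updateAt)
open import Data.Vec.Functional.Properties using (updateAt-updates; updateAt-minimal)
open import Function using (_∘_; const)
open import Relation.Binary.Definitions using (tri<; tri≈; tri>)
open import Relation.Binary.PropositionalEquality
open import Relation.Nullary using (¬_; yes; no; contradiction)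
open import Relation.Nullary.Decidable using (dec⇒maybe; from-yes)
open import Tactic.RingSolver using (solve-∀)
import Tactic.RingSolver.Core.AlmostCommutativeRing as ACR

open import Algebra.Properties.Monoid.Sum ℕ.+-0-monoid using () renaming (sum to sumℕ; sum-cong-≗ to sumℕ-cong)
open import Algebra.Properties.Group ℚ.+-0-group using () renaming (⁻¹-involutive to ℚ-neg-involutive)

-- Finite sums over a commutative ring, shared by `sumℤ` and `sumℚ`

module FinSum {R : Set} {_⊕_ _⊗_ : R → R → R} {⊖_ : R → R} {0# 1# : R}
  (isCommutativeRing : IsCommutativeRing _≡_ _⊕_ _⊗_ ⊖_ 0# 1#)
  (sum : ∀ {n} → (Fin n → R) → R)
  (sum-[] : (f : Fin 0 → R) → sum f ≡ 0#)
  (sum-∷ : ∀ {n} (f : Fin (suc n) → R) → sum f ≡ (f zero ⊕ sum (f ∘ suc)))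
  where

  open IsCommutativeRing isCommutativeRing
    using (+-assoc; +-comm; +-identityʳ; zeroʳ; distribˡ)

  interchange : ∀ a b c d → ((a ⊕ b) ⊕ (c ⊕ d)) ≡ ((a ⊕ c) ⊕ (b ⊕ d))
  interchange a b c d = begin
    (a ⊕ b) ⊕ (c ⊕ d) ≡⟨ +-assoc a b _ ⟩
    a ⊕ (b ⊕ (c ⊕ d)) ≡⟨ cong (a ⊕_) (sym (+-assoc b c d)) ⟩
    a ⊕ ((b ⊕ c) ⊕ d) ≡⟨ cong (λ e → a ⊕ (e ⊕ d)) (+-comm b c) ⟩
    a ⊕ ((c ⊕ b) ⊕ d) ≡⟨ cong (a ⊕_) (+-assoc c b d) ⟩
    a ⊕ (c ⊕ (b ⊕ d)) ≡⟨ sym (+-assoc a c _) ⟩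
    (a ⊕ c) ⊕ (b ⊕ d) ∎
    where open ≡-Reasoning

  sum-cong : ∀ {n} {f g : Fin n → R} → (∀ k → f k ≡ g k) → sum f ≡ sum g
  sum-cong {zero}  {f} {g} e = trans (sum-[] f) (sym (sum-[] g))
  sum-cong {suc n} {f} {g} e =
    trans (sum-∷ f) (trans (cong₂ _⊕_ (e zero) (sum-cong (e ∘ suc))) (sym (sum-∷ g)))

  sum-zero : ∀ {n} {f : Fin n → R} → (∀ k → f k ≡ 0#) → sum f ≡ 0#
  sum-zero {zero}  {f} e = sum-[] f
  sum-zero {suc n} {f} e =
    trans (sum-∷ f) (trans (cong₂ _⊕_ (e zero) (sum-zero (e ∘ suc))) (+-identityʳ 0#))

  sum-+ : ∀ {n} (f g : Fin n → R) → sum (λ k → f k ⊕ g k) ≡ (sum f ⊕ sum g)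
  sum-+ {zero}  f g = trans (sum-[] _)
    (sym (trans (cong₂ _⊕_ (sum-[] f) (sum-[] g)) (+-identityʳ 0#)))
  sum-+ {suc n} f g = begin
    sum (λ k → f k ⊕ g k)                                        ≡⟨ sum-∷ _ ⟩
    (f zero ⊕ g zero) ⊕ sum (λ k → f (suc k) ⊕ g (suc k))        ≡⟨ cong (_ ⊕_) (sum-+ (f ∘ suc) (g ∘ suc)) ⟩
    (f zero ⊕ g zero) ⊕ (sum (f ∘ suc) ⊕ sum (g ∘ suc))          ≡⟨ interchange _ _ _ _ ⟩
    (f zero ⊕ sum (f ∘ suc)) ⊕ (g zero ⊕ sum (g ∘ suc))          ≡⟨ sym (cong₂ _⊕_ (sum-∷ f) (sum-∷ g)) ⟩
    sum f ⊕ sum g                                                ∎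
    where open ≡-Reasoning

  sum-* : ∀ {n} x (f : Fin n → R) → sum (λ k → x ⊗ f k) ≡ (x ⊗ sum f)
  sum-* {zero}  x f = trans (sum-[] _) (sym (trans (cong (x ⊗_) (sum-[] f)) (zeroʳ x)))
  sum-* {suc n} x f = begin
    sum (λ k → x ⊗ f k)                      ≡⟨ sum-∷ _ ⟩
    (x ⊗ f zero) ⊕ sum (λ k → x ⊗ f (suc k)) ≡⟨ cong (_ ⊕_) (sum-* x (f ∘ suc)) ⟩
    (x ⊗ f zero) ⊕ (x ⊗ sum (f ∘ suc))       ≡⟨ sym (distribˡ x _ _) ⟩
    x ⊗ (f zero ⊕ sum (f ∘ suc))             ≡⟨ cong (x ⊗_) (sym (sum-∷ f)) ⟩
    x ⊗ sum f                                ∎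
    where open ≡-Reasoning

  sum-swap : ∀ {m n} (f : Fin m → Fin n → R) →
    sum (λ i → sum (f i)) ≡ sum (λ j → sum (λ i → f i j))
  sum-swap {zero}  f = trans (sum-[] _) (sym (sum-zero (λ j → sum-[] _)))
  sum-swap {suc m} f = begin
    sum (λ i → sum (f i))                                  ≡⟨ sum-∷ _ ⟩
    sum (f zero) ⊕ sum (λ i → sum (f (suc i)))             ≡⟨ cong (sum (f zero) ⊕_) (sum-swap (f ∘ suc)) ⟩
    sum (f zero) ⊕ sum (λ j → sum (λ i → f (suc i) j))     ≡⟨ sym (sum-+ _ _) ⟩
    sum (λ j → f zero j ⊕ sum (λ i → f (suc i) j))         ≡⟨ sum-cong (λ j → sym (sum-∷ _)) ⟩
    sum (λ j → sum (λ i → f i j))                          ∎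
    where open ≡-Reasoning

  -- Handles every change of a single entry: an added column, an updated vector, a halved convex
  -- weight. `sum-single` is the case where `g` vanishes.
  sum-differ : ∀ {n} {f g : Fin n → R} a d →
    (∀ k → k ≢ a → f k ≡ g k) → f a ≡ (g a ⊕ d) → sum f ≡ (sum g ⊕ d)
  sum-differ {suc n} {f} {g} zero d e e₀ = begin
    sum f                              ≡⟨ sum-∷ f ⟩
    f zero ⊕ sum (f ∘ suc)             ≡⟨ cong₂ _⊕_ e₀ (sum-cong (λ k → e (suc k) λ ())) ⟩
    (g zero ⊕ d) ⊕ sum (g ∘ suc)       ≡⟨ +-assoc _ _ _ ⟩
    g zero ⊕ (d ⊕ sum (g ∘ suc))       ≡⟨ cong (_ ⊕_) (+-comm _ _) ⟩
    g zero ⊕ (sum (g ∘ suc) ⊕ d)       ≡⟨ sym (+-assoc _ _ _) ⟩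
    (g zero ⊕ sum (g ∘ suc)) ⊕ d       ≡⟨ cong (_⊕ d) (sym (sum-∷ g)) ⟩
    sum g ⊕ d                          ∎
    where open ≡-Reasoning
  sum-differ {suc n} {f} {g} (suc a) d e e₀ = begin
    sum f                              ≡⟨ sum-∷ f ⟩
    f zero ⊕ sum (f ∘ suc)             ≡⟨ cong₂ _⊕_ (e zero λ ())
                                            (sum-differ a d (λ k k≢a → e (suc k) (k≢a ∘ Fin.suc-injective)) e₀) ⟩
    g zero ⊕ (sum (g ∘ suc) ⊕ d)       ≡⟨ sym (+-assoc _ _ _) ⟩
    (g zero ⊕ sum (g ∘ suc)) ⊕ d       ≡⟨ cong (_⊕ d) (sym (sum-∷ g)) ⟩
    sum g ⊕ d                          ∎
    where open ≡-Reasoning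

  sum-single : ∀ {n} {f : Fin n → R} a → (∀ k → k ≢ a → f k ≡ 0#) → sum f ≡ f a
  sum-single {n} {f} a e = begin
    sum f                            ≡⟨ sum-differ {g = λ _ → 0#} a (f a) e (sym (trans (+-comm _ _) (+-identityʳ _))) ⟩
    sum {n} (λ _ → 0#) ⊕ f a         ≡⟨ cong (_⊕ f a) (sum-zero (λ _ → refl)) ⟩
    0# ⊕ f a                         ≡⟨ trans (+-comm _ _) (+-identityʳ _) ⟩
    f a                              ∎
    where open ≡-Reasoning

module Σℤ = FinSum ℤ.+-*-isCommutativeRing sumℤ (λ _ → refl) (λ _ → refl)

Matrixℤ : ℕ → ℕ → Set
Matrixℤ m n = Fin m → Fin n → ℤ

-- Determinants under column operations

minor : ∀ {n} → Matrixℤ (suc n) (suc n) → Fin (suc n) → Matrixℤ n n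
minor M j r c = M (suc r) (punchIn j c)

laplaceTerm : ∀ {n} → Matrixℤ (suc n) (suc n) → Fin (suc n) → ℤ
laplaceTerm M j = sgn j ℤ.* (M zero j ℤ.* det (minor M j))

det-cong : ∀ {n} {M N : Matrixℤ n n} → (∀ r c → M r c ≡ N r c) → det M ≡ det N
det-cong {zero}  e = refl
det-cong {suc n} e = Σℤ.sum-cong λ j →
  cong (sgn j ℤ.*_) (cong₂ ℤ._*_ (e zero j) (det-cong (λ r c → e (suc r) (punchIn j c))))

-- In the Laplace expansion the term `j = k` splits through its entry, since its minor omits column
-- `k`; every other term splits through its minor, by induction in the column to which `k` moves.
det-linear : ∀ {n} {M N P : Matrixℤ n n} k x →
  (∀ r c → c ≢ k → M r c ≡ N r c) → (∀ r c → c ≢ k → M r c ≡ P r c) →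
  (∀ r → M r k ≡ N r k ℤ.+ x ℤ.* P r k) →
  det M ≡ det N ℤ.+ x ℤ.* det P
det-linear {suc n} {M} {N} {P} k x M≗N M≗P Mk = begin
  sumℤ (laplaceTerm M)                                          ≡⟨ Σℤ.sum-cong term ⟩
  sumℤ (λ j → laplaceTerm N j ℤ.+ x ℤ.* laplaceTerm P j)        ≡⟨ Σℤ.sum-+ (laplaceTerm N) (λ j → x ℤ.* laplaceTerm P j) ⟩
  det N ℤ.+ sumℤ (λ j → x ℤ.* laplaceTerm P j)                  ≡⟨ cong (ℤ._+_ (det N)) (Σℤ.sum-* x (laplaceTerm P)) ⟩
  det N ℤ.+ x ℤ.* det P                                         ∎
  where
  open ≡-Reasoning
  entry-split : ∀ s a y b d → s ℤ.* ((a ℤ.+ y ℤ.* b) ℤ.* d) ≡ s ℤ.* (a ℤ.* d) ℤ.+ y ℤ.* (s ℤ.* (b ℤ.* d))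
  entry-split = ℤ-Ring.solve-∀
  minor-split : ∀ s a y d e → s ℤ.* (a ℤ.* (d ℤ.+ y ℤ.* e)) ≡ s ℤ.* (a ℤ.* d) ℤ.+ y ℤ.* (s ℤ.* (a ℤ.* e))
  minor-split = ℤ-Ring.solve-∀
  punched : ∀ {j} (j≢k : j ≢ k) c → punchIn j c ≡ k → c ≡ punchOut j≢k
  punched {j} j≢k c e = Fin.punchIn-injective j _ _ (trans e (sym (Fin.punchIn-punchOut j≢k)))
  term : ∀ j → laplaceTerm M j ≡ laplaceTerm N j ℤ.+ x ℤ.* laplaceTerm P j
  term j with j Fin.≟ k
  ... | yes refl
    rewrite Mk zero
    | det-cong {M = minor M j} {minor N j} (λ r c → M≗N (suc r) _ (Fin.punchInᵢ≢i j c))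
    | det-cong {M = minor P j} {minor N j}
        (λ r c → trans (sym (M≗P (suc r) _ (Fin.punchInᵢ≢i j c))) (M≗N (suc r) _ (Fin.punchInᵢ≢i j c)))
    = entry-split (sgn j) (N zero j) x (P zero j) (det (minor N j))
  ... | no j≢k
    rewrite det-linear {M = minor M j} {minor N j} {minor P j} (punchOut j≢k) x
        (λ r c c≢ → M≗N (suc r) _ (c≢ ∘ punched j≢k c)) (λ r c c≢ → M≗P (suc r) _ (c≢ ∘ punched j≢k c))
        (λ r → subst (λ l → M (suc r) l ≡ N (suc r) l ℤ.+ x ℤ.* P (suc r) l)
                 (sym (Fin.punchIn-punchOut j≢k)) (Mk (suc r)))
    | sym (M≗N zero j j≢k) | sym (M≗P zero j j≢k)
    = minor-split (sgn j) (M zero j) x _ _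

-- Restricting to adjacent columns makes alternation a cancellation of two consecutive Laplace
-- terms, and it is enough for Euclidean steps between neighbours.
data Adjacent : ∀ {n} → Fin n → Fin n → Set where
  here  : ∀ {n} → Adjacent {suc (suc n)} zero (suc zero)
  there : ∀ {n} {a b : Fin n} → Adjacent a b → Adjacent (suc a) (suc b)

adjacent-≢ : ∀ {n} {a b : Fin n} → Adjacent a b → a ≢ b
adjacent-≢ (there ab) e = adjacent-≢ ab (Fin.suc-injective e)

adjacent-inject₁ : ∀ {n} (i : Fin n) → Adjacent (inject₁ i) (suc i)
adjacent-inject₁ zero    = here
adjacent-inject₁ (suc i) = there (adjacent-inject₁ i)

adjacent-punchOut : ∀ {n} {a b : Fin (suc n)} → Adjacent a b → ∀ j → j ≢ a → j ≢ b →
  ∃₂ λ a′ b′ → Adjacent a′ b′ × punchIn j a′ ≡ a × punchIn j b′ ≡ b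
adjacent-punchOut here zero j≢a j≢b = contradiction refl j≢a
adjacent-punchOut here (suc zero) j≢a j≢b = contradiction refl j≢b
adjacent-punchOut {suc (suc n)} here (suc (suc j)) j≢a j≢b = zero , suc zero , here , refl , refl
adjacent-punchOut (there ab) zero j≢a j≢b = _ , _ , ab , refl , refl
adjacent-punchOut {suc n} (there ab) (suc j) j≢a j≢b
  with adjacent-punchOut ab j (j≢a ∘ cong suc) (j≢b ∘ cong suc)
... | a′ , b′ , ab′ , ea , eb = suc a′ , suc b′ , there ab′ , cong suc ea , cong suc eb

-- This makes the minors at `a` and `b` coincide once columns `a` and `b` are equal: after either
-- deletion the survivor of the pair sits in the same position.
adjacent-punchIn : ∀ {n} {a b : Fin (suc n)} → Adjacent a b → ∀ c →
  punchIn a c ≡ punchIn b c ⊎ (punchIn a c ≡ b × punchIn b c ≡ a)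
adjacent-punchIn here zero    = inj₂ (refl , refl)
adjacent-punchIn here (suc c) = inj₁ refl
adjacent-punchIn (there ab) zero = inj₁ refl
adjacent-punchIn (there ab) (suc c) with adjacent-punchIn ab c
... | inj₁ e         = inj₁ (cong suc e)
... | inj₂ (e₁ , e₂) = inj₂ (cong suc e₁ , cong suc e₂)

sgn-adjacent : ∀ {n} {a b : Fin n} → Adjacent a b → sgn b ≡ ℤ.- sgn a
sgn-adjacent here       = refl
sgn-adjacent (there ab) = cong ℤ.-_ (sgn-adjacent ab)

sum-adjacent : ∀ {n} {a b : Fin n} {f : Fin n → ℤ} → Adjacent a b →
  (∀ j → j ≢ a → j ≢ b → f j ≡ 0ℤ) → f a ℤ.+ f b ≡ 0ℤ → sumℤ f ≡ 0ℤ
sum-adjacent {f = f} here e e₀ = begin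
  f zero ℤ.+ (f (suc zero) ℤ.+ _)  ≡⟨ cong (λ y → f zero ℤ.+ (f (suc zero) ℤ.+ y)) (Σℤ.sum-zero (λ k → e (suc (suc k)) (λ ()) λ ())) ⟩
  f zero ℤ.+ (f (suc zero) ℤ.+ 0ℤ) ≡⟨ cong (ℤ._+_ (f zero)) (ℤ.+-identityʳ _) ⟩
  f zero ℤ.+ f (suc zero)          ≡⟨ e₀ ⟩
  0ℤ                               ∎
  where open ≡-Reasoning
sum-adjacent (there ab) e e₀ = cong₂ ℤ._+_ (e zero (λ ()) λ ())
  (sum-adjacent ab (λ j j≢a j≢b → e (suc j) (j≢a ∘ Fin.suc-injective) (j≢b ∘ Fin.suc-injective)) e₀)

-- Induction kills every minor that still contains both equal columns; the two remaining Laplace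
-- terms have equal entries and minors but opposite signs.
det-alternating : ∀ {n} {M : Matrixℤ n n} {a b} → Adjacent a b → (∀ r → M r a ≡ M r b) → det M ≡ 0ℤ
det-alternating {suc n} {M} {a} {b} ab e = sum-adjacent {f = laplaceTerm M} ab other cancel
  where
  other : ∀ j → j ≢ a → j ≢ b → laplaceTerm M j ≡ 0ℤ
  other j j≢a j≢b with adjacent-punchOut ab j j≢a j≢b
  ... | a′ , b′ , ab′ , ea , eb
    rewrite det-alternating {M = minor M j} ab′
      (λ r → trans (cong (M (suc r)) ea) (trans (e (suc r)) (cong (M (suc r)) (sym eb))))
    | ℤ.*-zeroʳ (M zero j) = ℤ.*-zeroʳ (sgn j)
  minors : ∀ r c → minor M a r c ≡ minor M b r c
  minors r c with adjacent-punchIn ab c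
  ... | inj₁ e′        = cong (M (suc r)) e′
  ... | inj₂ (ea , eb) = trans (cong (M (suc r)) ea) (trans (sym (e (suc r))) (cong (M (suc r)) (sym eb)))
  opposite : ∀ s x → s ℤ.* x ℤ.+ (ℤ.- s) ℤ.* x ≡ 0ℤ
  opposite = ℤ-Ring.solve-∀
  cancel : laplaceTerm M a ℤ.+ laplaceTerm M b ≡ 0ℤ
  cancel rewrite sgn-adjacent ab | sym (e zero) | det-cong {M = minor M a} {minor M b} minors
    = opposite (sgn a) _

Neighbours : ∀ {n} → Fin n → Fin n → Set
Neighbours a b = Adjacent a b ⊎ Adjacent b a

neighbours-≢ : ∀ {n} {a b : Fin n} → Neighbours a b → a ≢ b
neighbours-≢ = [ adjacent-≢ , (λ ba → adjacent-≢ ba ∘ sym) ]′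

addColumn : ∀ {m n} → Fin n → Fin n → ℤ → Matrixℤ m n → Matrixℤ m n
addColumn a b x M r = updateAt (M r) b (ℤ._+ x ℤ.* M r a)

-- Linearity in column `b` leaves an extra determinant in which column `b` is a copy of column `a`.
det-addColumn : ∀ {n} {a b : Fin n} → Neighbours a b → ∀ x M → det (addColumn a b x M) ≡ det M
det-addColumn {n} {a} {b} nb x M = begin
  det (addColumn a b x M)     ≡⟨ det-linear b x (λ r c c≢b → updateAt-minimal c b (M r) c≢b)
                                   (λ r c c≢b → trans (updateAt-minimal c b (M r) c≢b) (sym (updateAt-minimal c b (M r) c≢b)))
                                   (λ r → trans (updateAt-updates b (M r))
                                            (cong (λ y → M r b ℤ.+ x ℤ.* y) (sym (updateAt-updates b (M r))))) ⟩
  det M ℤ.+ x ℤ.* det P       ≡⟨ cong (λ d → det M ℤ.+ x ℤ.* d) (repeated nb) ⟩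
  det M ℤ.+ x ℤ.* 0ℤ          ≡⟨ cong (ℤ._+_ (det M)) (ℤ.*-zeroʳ x) ⟩
  det M ℤ.+ 0ℤ                ≡⟨ ℤ.+-identityʳ _ ⟩
  det M                       ∎
  where
  open ≡-Reasoning
  P : Matrixℤ n n
  P r = updateAt (M r) b (const (M r a))
  Pa≡Pb : ∀ r → P r a ≡ P r b
  Pa≡Pb r = trans (updateAt-minimal a b (M r) (neighbours-≢ nb)) (sym (updateAt-updates b (M r)))
  repeated : Neighbours a b → det P ≡ 0ℤ
  repeated (inj₁ ab) = det-alternating ab Pa≡Pb
  repeated (inj₂ ba) = det-alternating ba (sym ∘ Pa≡Pb)

-- The column lattice under column operations

infixr 7 _·_

_·_ : ∀ {m n} → Matrixℤ m n → ℤVec n → ℤVec m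
(M · w) r = sumℤ (λ c → M r c ℤ.* w c)

-- Adding a multiple of a column multiplies `M` on the right by an elementary matrix, so it can be
-- moved onto the vector. Both sides exceed `(M · w) r` by `d`.
addColumn-· : ∀ {m n} {a b : Fin n} → a ≢ b → ∀ x (M : Matrixℤ m n) w r →
  (addColumn a b x M · w) r ≡ (M · updateAt w a (ℤ._+ x ℤ.* w b)) r
addColumn-· {a = a} {b} a≢b x M w r = begin
  (addColumn a b x M · w) r                        ≡⟨ Σℤ.sum-differ b d
      (λ c c≢b → cong (ℤ._* w c) (updateAt-minimal c b (M r) c≢b))
      (trans (cong (ℤ._* w b) (updateAt-updates b (M r))) (expandˡ (M r b) x (M r a) (w b))) ⟩
  (M · w) r ℤ.+ d                                  ≡⟨ sym (Σℤ.sum-differ a d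
      (λ c c≢a → cong (M r c ℤ.*_) (updateAt-minimal c a w c≢a))
      (trans (cong (M r a ℤ.*_) (updateAt-updates a w)) (expandʳ (M r a) (w a) x (w b)))) ⟩
  (M · updateAt w a (ℤ._+ x ℤ.* w b)) r            ∎
  where
  open ≡-Reasoning
  d : ℤ
  d = x ℤ.* M r a ℤ.* w b
  expandˡ : ∀ p y q v → (p ℤ.+ y ℤ.* q) ℤ.* v ≡ p ℤ.* v ℤ.+ y ℤ.* q ℤ.* v
  expandˡ = ℤ-Ring.solve-∀
  expandʳ : ∀ q u y v → q ℤ.* (u ℤ.+ y ℤ.* v) ≡ q ℤ.* u ℤ.+ y ℤ.* q ℤ.* v
  expandʳ = ℤ-Ring.solve-∀

·-congʳ : ∀ {m n} (M : Matrixℤ m n) {w w′ : ℤVec n} → (∀ c → w c ≡ w′ c) → ∀ r → (M · w) r ≡ (M · w′) r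
·-congʳ M e r = Σℤ.sum-cong (λ c → cong (M r c ℤ.*_) (e c))

-- Unimodular column equivalence, kept only through what it preserves: the determinant with its
-- sign, and the column lattice by `from` and `to`.
record _≈col_ {n} (M N : Matrixℤ n n) : Set where
  field
    det≡ : det N ≡ det M
    from : ∀ w → ∃ λ w′ → ∀ r → (N · w) r ≡ (M · w′) r
    to   : ∀ w → ∃ λ w′ → ∀ r → (M · w) r ≡ (N · w′) r

open _≈col_

≈col-refl : ∀ {n} {M : Matrixℤ n n} → M ≈col M
≈col-refl .det≡   = refl
≈col-refl .from w = w , λ _ → refl
≈col-refl .to w   = w , λ _ → refl

≈col-trans : ∀ {n} {L M N : Matrixℤ n n} → L ≈col M → M ≈col N → L ≈col N
≈col-trans p q .det≡ = trans (det≡ q) (det≡ p)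
≈col-trans p q .from w =
  let w₁ , e₁ = from q w ; w₂ , e₂ = from p w₁ in w₂ , λ r → trans (e₁ r) (e₂ r)
≈col-trans p q .to w =
  let w₁ , e₁ = to p w ; w₂ , e₂ = to q w₁ in w₂ , λ r → trans (e₁ r) (e₂ r)

≈col-addColumn : ∀ {n} {a b : Fin n} → Neighbours a b → ∀ x M → M ≈col addColumn a b x M
≈col-addColumn nb x M .det≡ = det-addColumn nb x M
≈col-addColumn nb x M .from w = _ , addColumn-· (neighbours-≢ nb) x M w
≈col-addColumn {n} {a} {b} nb x M .to w = w′ , λ r →
  sym (trans (addColumn-· (neighbours-≢ nb) x M w′ r) (·-congʳ M restored r))
  where
  -- The inverse elementary operation, with factor `- x`.
  w′ : ℤVec n
  w′ = updateAt w a (ℤ._+ (ℤ.- x) ℤ.* w b)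
  undo : ∀ u y v → u ℤ.+ (ℤ.- y) ℤ.* v ℤ.+ y ℤ.* v ≡ u
  undo = ℤ-Ring.solve-∀
  restored : ∀ c → updateAt w′ a (ℤ._+ x ℤ.* w′ b) c ≡ w c
  restored c with c Fin.≟ a
  ... | yes refl = begin
    updateAt w′ c (ℤ._+ x ℤ.* w′ b) c                 ≡⟨ updateAt-updates c w′ ⟩
    w′ c ℤ.+ x ℤ.* w′ b                               ≡⟨ cong₂ (λ u v → u ℤ.+ x ℤ.* v) (updateAt-updates c w)
                                                          (updateAt-minimal b c w (neighbours-≢ nb ∘ sym)) ⟩
    w c ℤ.+ (ℤ.- x) ℤ.* w b ℤ.+ x ℤ.* w b             ≡⟨ undo (w c) x (w b) ⟩
    w c                                               ∎
    where open ≡-Reasoning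
  ... | no c≢a = trans (updateAt-minimal c a w′ c≢a) (updateAt-minimal c a w c≢a)

-- Reducing the first row by the Euclidean algorithm

-- `unchanged` protects the zeros already produced in the first row while columns `a` and `b` are
-- being worked on.
record ColumnsChanged {n} (M : Matrixℤ (suc n) (suc n)) (a b : Fin (suc n)) (Q : Matrixℤ (suc n) (suc n) → Set) : Set where
  constructor changed
  field
    result    : Matrixℤ (suc n) (suc n)
    ≈result   : M ≈col result
    unchanged : ∀ c → c ≢ a → c ≢ b → result zero c ≡ M zero c
    property  : Q result

module _ {n : ℕ} where

  private
    Sq : Set
    Sq = Matrixℤ (suc n) (suc n)

  addColumn-step : ∀ {a b} {Q : Sq → Set} → Neighbours a b → ∀ x (M : Sq) →
    ColumnsChanged (addColumn a b x M) a b Q → ColumnsChanged M a b Q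
  addColumn-step {a} {b} nb x M (changed N M≈N same q) =
    changed N (≈col-trans (≈col-addColumn nb x M) M≈N)
      (λ c c≢a c≢b → trans (same c c≢a c≢b) (updateAt-minimal c b (M zero) c≢b)) q

  swap-columns : ∀ {a b} {Q : Sq → Set} {M : Sq} → ColumnsChanged M a b Q → ColumnsChanged M b a Q
  swap-columns (changed N M≈N same q) = changed N M≈N (λ c c≢b c≢a → same c c≢a c≢b) q

  -- Exchanging the columns would change the sign of the determinant, so column `b` is added to `a`
  -- and then `a` is subtracted from `b`: the two entries go from `(0, y)` to `(y, y)` to `(y, 0)`.
  transfer-zero : ∀ {a b} → Neighbours a b → (M : Sq) → M zero a ≡ 0ℤ →
    ColumnsChanged M a b (λ N → N zero b ≡ 0ℤ)
  transfer-zero {a} {b} nb M Ma≡0 =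
    swap-columns (addColumn-step (swap nb) 1ℤ M (swap-columns (addColumn-step nb -1ℤ M₁
      (changed M₂ ≈col-refl (λ _ _ _ → refl) M₂b≡0))))
    where
    M₁ M₂ : Sq
    M₁ = addColumn b a 1ℤ M
    M₂ = addColumn a b -1ℤ M₁
    M₂b≡0 : M₂ zero b ≡ 0ℤ
    M₂b≡0 = begin
      M₂ zero b                                          ≡⟨ updateAt-updates b (M₁ zero) ⟩
      M₁ zero b ℤ.+ -1ℤ ℤ.* M₁ zero a                    ≡⟨ cong₂ (λ u v → u ℤ.+ -1ℤ ℤ.* v)
                                                             (updateAt-minimal b a (M zero) (neighbours-≢ nb ∘ sym))
                                                             (updateAt-updates a (M zero)) ⟩
      M zero b ℤ.+ -1ℤ ℤ.* (M zero a ℤ.+ 1ℤ ℤ.* M zero b) ≡⟨ cong (λ u → M zero b ℤ.+ -1ℤ ℤ.* (u ℤ.+ 1ℤ ℤ.* M zero b)) Ma≡0 ⟩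
      M zero b ℤ.+ -1ℤ ℤ.* (0ℤ ℤ.+ 1ℤ ℤ.* M zero b)       ≡⟨ cancel (M zero b) ⟩
      0ℤ                                                 ∎
      where
      open ≡-Reasoning
      cancel : ∀ y → y ℤ.+ -1ℤ ℤ.* (0ℤ ℤ.+ 1ℤ ℤ.* y) ≡ 0ℤ
      cancel = ℤ-Ring.solve-∀

  -- Euclid's algorithm on the entries of columns `a` and `b`: replacing entry `b` by its remainder
  -- modulo entry `a` gives a smaller divisor for the call with the columns exchanged.
  clear-entry : ∀ {a b} → Neighbours a b → (M : Sq) → Acc ℕ._<_ ∣ M zero a ∣ →
    ColumnsChanged M a b (λ N → N zero b ≡ 0ℤ)
  clear-entry {a} {b} nb M (acc rs) with M zero a ℤ.≟ 0ℤ
  ... | yes Ma≡0 = transfer-zero nb M Ma≡0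
  ... | no  Ma≢0 = addColumn-step nb (ℤ.- q) M (finish (clear-entry (swap nb) M₁ (rs smaller)))
    where
    instance
      nz : ℤ.NonZero (M zero a)
      nz = ℤ.≢-nonZero Ma≢0
    q : ℤ
    q = M zero b ℤ./ M zero a
    M₁ : Sq
    M₁ = addColumn a b (ℤ.- q) M
    remainder : ∀ y x p r → y ≡ r ℤ.+ p ℤ.* x → y ℤ.+ (ℤ.- p) ℤ.* x ≡ r
    remainder y x p r refl = lem r p x
      where
      lem : ∀ r p x → r ℤ.+ p ℤ.* x ℤ.+ (ℤ.- p) ℤ.* x ≡ r
      lem = ℤ-Ring.solve-∀
    M₁b : M₁ zero b ≡ + (M zero b ℤ.% M zero a)
    M₁b = trans (updateAt-updates b (M zero))
      (remainder (M zero b) (M zero a) q _ (ℤ.a≡a%n+[a/n]*n (M zero b) (M zero a)))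
    smaller : ∣ M₁ zero b ∣ ℕ.< ∣ M zero a ∣
    smaller = subst (λ u → ∣ u ∣ ℕ.< ∣ M zero a ∣) (sym M₁b) (ℤ.n%d<d (M zero b) (M zero a))
    -- The exchanged call clears column `a`, so the zero still has to be moved to `b`.
    finish : ColumnsChanged M₁ b a (λ N → N zero a ≡ 0ℤ) → ColumnsChanged M₁ a b (λ N → N zero b ≡ 0ℤ)
    finish (changed N M₁≈N same Na≡0) with transfer-zero nb N Na≡0
    ... | changed N′ N≈N′ same′ N′b≡0 = changed N′ (≈col-trans M₁≈N N≈N′)
      (λ c c≢a c≢b → trans (same′ c c≢a c≢b) (same c c≢b c≢a)) N′b≡0

  -- Columns are cleared from the last one leftwards. Each step alters only two neighbouring
  -- columns, so the zeros further right survive.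
  reduce-row : (M : Sq) → ∃ λ N → M ≈col N × (∀ c → N zero (suc c) ≡ 0ℤ)
  reduce-row M =
    let N , M≈N , N≡0 = Fin.>-weakInduction ClearedBeyond start step zero
    in N , M≈N , λ c → N≡0 (suc c) (s≤s z≤n)
    where
    ClearedBeyond : Fin (suc n) → Set
    ClearedBeyond b = ∃ λ N → M ≈col N × (∀ c → b Fin.< c → N zero c ≡ 0ℤ)
    start : ClearedBeyond (fromℕ n)
    start = M , ≈col-refl , λ c n<c → contradiction (Fin.≤fromℕ c) (ℕ.<⇒≱ n<c)
    step : ∀ i → ClearedBeyond (suc i) → ClearedBeyond (inject₁ i)
    step i (N , M≈N , N≡0) with clear-entry (inj₁ (adjacent-inject₁ i)) N (<-wellFounded _)
    ... | changed N′ N≈N′ same N′b≡0 = N′ , ≈col-trans M≈N N≈N′ , cleared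
      where
      cleared : ∀ c → inject₁ i Fin.< c → N′ zero c ≡ 0ℤ
      cleared c i<c with c Fin.≟ suc i
      ... | yes refl  = N′b≡0
      ... | no c≢1+i = trans
        (same c (λ { refl → ℕ.<-irrefl refl i<c }) c≢1+i)
        (N≡0 c (ℕ.≤∧≢⇒< (subst (ℕ._< toℕ c) (Fin.toℕ-inject₁ i) i<c) (c≢1+i ∘ sym ∘ Fin.toℕ-injective)))

-- Residues modulo the lattice spanned by the columns

-- Full rank, phrased so that it passes to the lower right block once the first row has been reduced.
Spanning : ∀ {n} → Matrixℤ n n → Set
Spanning M = ∀ r → ∃ λ w → (∀ s → s ≢ r → (M · w) s ≡ 0ℤ) × (M · w) r ≢ 0ℤ

spanning-≈col : ∀ {n} {M N : Matrixℤ n n} → M ≈col N → Spanning M → Spanning N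
spanning-≈col M≈N sp r with sp r
... | w , e , e≢0 with to M≈N w
... | w′ , e′ = w′ , (λ s s≢r → trans (sym (e′ s)) (e s s≢r)) , e≢0 ∘ trans (e′ r)

-- `ρ` separates the cosets of the lattice of all `M · w`, which bounds its index by `d`. It may
-- split a coset into several classes.
Residues : ∀ {n} → Matrixℤ n n → ℕ → Set
Residues {n} M d = Σ (ℤVec n → Fin d) λ ρ →
  ∀ v v′ → ρ v ≡ ρ v′ → ∃ λ w → ∀ r → v′ r ≡ v r ℤ.+ (M · w) r

module ReducedRow {n} (N : Matrixℤ (suc n) (suc n)) (N≡0 : ∀ c → N zero (suc c) ≡ 0ℤ) where

  g : ℤ
  g = N zero zero

  C : Matrixℤ n n
  C r c = N (suc r) (suc c)

  det-N : det N ≡ g ℤ.* det C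
  det-N = trans (Σℤ.sum-single {f = laplaceTerm N} zero term≡0) (ℤ.*-identityˡ _)
    where
    term≡0 : ∀ j → j ≢ zero → laplaceTerm N j ≡ 0ℤ
    term≡0 zero    j≢0 = contradiction refl j≢0
    term≡0 (suc j) _ rewrite N≡0 j = ℤ.*-zeroʳ (sgn (suc j))

  ·-zero : ∀ w → (N · w) zero ≡ g ℤ.* w zero
  ·-zero w = trans (cong (ℤ._+_ (g ℤ.* w zero)) (Σℤ.sum-zero λ c → cong (ℤ._* w (suc c)) (N≡0 c)))
    (ℤ.+-identityʳ _)

  spanning-g : Spanning N → g ≢ 0ℤ
  spanning-g sp g≡0 with sp zero
  ... | w , _ , Nw≢0 = Nw≢0 (trans (·-zero w) (cong (ℤ._* w zero) g≡0))

  -- The corner `g` is nonzero, so a vector whose image vanishes in the first row has first entry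
  -- zero, and column zero contributes nothing below.
  spanning-C : Spanning N → Spanning C
  spanning-C sp r with sp (suc r)
  ... | w , Nw≡0 , Nw≢0 = w ∘ suc , (λ s s≢r → trans (sym (lower s)) (Nw≡0 (suc s) (s≢r ∘ Fin.suc-injective)))
      , Nw≢0 ∘ trans (lower r)
    where
    w₀≡0 : w zero ≡ 0ℤ
    w₀≡0 with ℤ.i*j≡0⇒i≡0∨j≡0 g (trans (sym (·-zero w)) (Nw≡0 zero λ ()))
    ... | inj₁ g≡0 = contradiction g≡0 (spanning-g sp)
    ... | inj₂ e   = e
    lower : ∀ s → (N · w) (suc s) ≡ (C · (w ∘ suc)) s
    lower s = trans (cong (ℤ._+ (C · (w ∘ suc)) s) (trans (cong (N (suc s) zero ℤ.*_) w₀≡0) (ℤ.*-zeroʳ (N (suc s) zero))))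
      (ℤ.+-identityˡ _)

  -- A mixed-radix residue: the remainder of `v zero` modulo `g`, paired with the `C`-residue of
  -- what remains after subtracting `quot v` times column zero.
  residues-step : g ≢ 0ℤ → Residues C ∣ det C ∣ → Residues N (∣ g ∣ ℕ.* ∣ det C ∣)
  residues-step g≢0 (ρC , ρC-lattice) = ρ , ρ-lattice
    where
    instance
      nz : ℤ.NonZero g
      nz = ℤ.≢-nonZero g≢0
    quot : ℤVec (suc n) → ℤ
    quot v = v zero ℤ./ g
    rest : ℤVec (suc n) → ℤVec n
    rest v r = v (suc r) ℤ.+ (ℤ.- quot v) ℤ.* N (suc r) zero
    rem : ℤVec (suc n) → Fin ∣ g ∣
    rem v = fromℕ< (ℤ.n%d<d (v zero) g)
    ρ : ℤVec (suc n) → Fin (∣ g ∣ ℕ.* ∣ det C ∣)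
    ρ v = combine (rem v) (ρC (rest v))
    ρ-lattice : ∀ v v′ → ρ v ≡ ρ v′ → ∃ λ w → ∀ r → v′ r ≡ v r ℤ.+ (N · w) r
    ρ-lattice v v′ e with Fin.combine-injective (rem v) _ (rem v′) _ e
    ... | rem≡ , ρC≡ with ρC-lattice (rest v) (rest v′) ρC≡
    ... | u , rest≡ = w , eq
      where
      -- Equal remainders make the first coordinates differ by `g` times the difference of the
      -- quotients; `u` accounts for the other rows.
      w : ℤVec (suc n)
      w zero    = quot v′ ℤ.+ ℤ.- quot v
      w (suc c) = u c
      %≡ : v zero ℤ.% g ≡ v′ zero ℤ.% g
      %≡ = Fin.fromℕ<-injective _ _ _ _ rem≡
      top : ∀ x x′ r q q′ h → x ≡ r ℤ.+ q ℤ.* h → x′ ≡ r ℤ.+ q′ ℤ.* h →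
        x′ ≡ x ℤ.+ h ℤ.* (q′ ℤ.+ ℤ.- q)
      top _ _ r q q′ h refl refl = lem r q q′ h
        where
        lem : ∀ r q q′ h → r ℤ.+ q′ ℤ.* h ≡ r ℤ.+ q ℤ.* h ℤ.+ h ℤ.* (q′ ℤ.+ ℤ.- q)
        lem = ℤ-Ring.solve-∀
      bottom : ∀ x x′ q q′ h s → x′ ℤ.+ (ℤ.- q′) ℤ.* h ≡ x ℤ.+ (ℤ.- q) ℤ.* h ℤ.+ s →
        x′ ≡ x ℤ.+ (h ℤ.* (q′ ℤ.+ ℤ.- q) ℤ.+ s)
      bottom x x′ q q′ h s e = trans (lem₁ x′ q′ h) (trans (cong (ℤ._+ q′ ℤ.* h) e) (lem₂ x q q′ h s))
        where
        lem₁ : ∀ x′ q′ h → x′ ≡ x′ ℤ.+ (ℤ.- q′) ℤ.* h ℤ.+ q′ ℤ.* h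
        lem₁ = ℤ-Ring.solve-∀
        lem₂ : ∀ x q q′ h s → x ℤ.+ (ℤ.- q) ℤ.* h ℤ.+ s ℤ.+ q′ ℤ.* h ≡ x ℤ.+ (h ℤ.* (q′ ℤ.+ ℤ.- q) ℤ.+ s)
        lem₂ = ℤ-Ring.solve-∀
      eq : ∀ r → v′ r ≡ v r ℤ.+ (N · w) r
      eq zero = trans
        (top (v zero) (v′ zero) (+ (v zero ℤ.% g)) (quot v) (quot v′) g
          (ℤ.a≡a%n+[a/n]*n (v zero) g)
          (trans (ℤ.a≡a%n+[a/n]*n (v′ zero) g) (cong (λ m → + m ℤ.+ quot v′ ℤ.* g) (sym %≡))))
        (cong (ℤ._+_ (v zero)) (sym (·-zero w)))
      eq (suc r) = bottom (v (suc r)) (v′ (suc r)) (quot v) (quot v′) (N (suc r) zero) _ (rest≡ r)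

-- Induction on the dimension through the block form: the numbers of classes multiply to
-- `∣ g ∣ * ∣ det C ∣`, which is `∣ det M ∣` since the column operations keep the determinant.
residues : ∀ {n} (M : Matrixℤ n n) → Spanning M → Residues M ∣ det M ∣
-- The empty determinant is 1, so there is exactly one class.
residues {zero}  M sp = (λ _ → zero) , λ _ _ _ → (λ ()) , λ ()
residues {suc n} M sp with reduce-row M
... | N , M≈N , N≡0 = pull (subst (Residues N) size (residues-step (spanning-g spN) (residues C (spanning-C spN))))
  where
  open ReducedRow N N≡0
  spN : Spanning N
  spN = spanning-≈col M≈N sp
  size : ∣ g ∣ ℕ.* ∣ det C ∣ ≡ ∣ det M ∣
  size = trans (sym (ℤ.abs-* g (det C))) (cong ∣_∣ (trans (sym det-N) (det≡ M≈N)))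
  pull : Residues N ∣ det M ∣ → Residues M ∣ det M ∣
  pull (ρ , ρ-lattice) = ρ , λ v v′ e →
    let w , eq = ρ-lattice v v′ e
        w′ , eq′ = from M≈N w
    in w′ , λ r → trans (eq r) (cong (ℤ._+_ (v r)) (eq′ r))

-- Lattice vectors in a box, by the pigeonhole principle

-- The first k units of the multiset s, taken greedily: a chain of length sumℕ s below s.
fill : ∀ {n} → ℕ → (Fin n → ℕ) → Fin n → ℕ
fill k s zero    = s zero ℕ.⊓ k
fill k s (suc j) = fill (k ℕ.∸ s zero) (s ∘ suc) j

fill-≤ : ∀ {n} k (s : Fin n → ℕ) j → fill k s j ℕ.≤ s j
fill-≤ k s zero    = ℕ.m⊓n≤m (s zero) k
fill-≤ k s (suc j) = fill-≤ (k ℕ.∸ s zero) (s ∘ suc) j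

fill-mono : ∀ {n k l} (s : Fin n → ℕ) → k ℕ.≤ l → ∀ j → fill k s j ℕ.≤ fill l s j
fill-mono s k≤l zero    = ℕ.⊓-monoʳ-≤ (s zero) k≤l
fill-mono s k≤l (suc j) = fill-mono (s ∘ suc) (ℕ.∸-monoˡ-≤ (s zero) k≤l) j

sum-fill : ∀ {n} k (s : Fin n → ℕ) → k ℕ.≤ sumℕ s → sumℕ (fill k s) ≡ k
sum-fill {zero}  k s k≤0 = sym (ℕ.n≤0⇒n≡0 k≤0)
sum-fill {suc n} k s k≤  = trans
  (cong (s zero ℕ.⊓ k ℕ.+_) (sum-fill (k ℕ.∸ s zero) (s ∘ suc)
    (subst (k ℕ.∸ s zero ℕ.≤_) (ℕ.m+n∸m≡n (s zero) _) (ℕ.∸-monoˡ-≤ (s zero) k≤))))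
  (ℕ.m⊓n+n∸m≡n (s zero) k)

-- The fills of `s` with 0 up to `∣ det M ∣` units outnumber the residue classes. Two of them in one
-- class differ by some `M · w`, and monotonicity of the chain puts this difference between zero and
-- `s`.
lattice-vector-in-box : ∀ {n} (M : Matrixℤ n n) → Spanning M → (s : Fin n → ℕ) → ∣ det M ∣ ℕ.≤ sumℕ s →
  ∃ λ w → ¬ (∀ k → w k ≡ 0ℤ) × (∀ r → ∃ λ t → t ℕ.≤ s r × (M · w) r ≡ + t)
lattice-vector-in-box M sp s d≤ with residues M sp
... | ρ , ρ-lattice with Fin.pigeonhole (ℕ.n<1+n ∣ det M ∣) (λ i → ρ (λ r → + fill (toℕ i) s r))
... | i , j , i<j , ρ≡ with ρ-lattice _ _ ρ≡
... | w , eq = w , w≢0 , λ r → fill (toℕ j) s r ℕ.∸ fill (toℕ i) s r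
      , ℕ.≤-trans (ℕ.m∸n≤m _ (fill (toℕ i) s r)) (fill-≤ (toℕ j) s r)
      , difference _ _ _ (fill-mono s (ℕ.<⇒≤ i<j) r) (eq r)
  where
  difference : ∀ p q x → p ℕ.≤ q → + q ≡ + p ℤ.+ x → x ≡ + (q ℕ.∸ p)
  difference p q x p≤q e = begin
    x                          ≡⟨ lem (+ p) x ⟩
    (+ p ℤ.+ x) ℤ.+ ℤ.- (+ p)  ≡⟨ cong (ℤ._+ ℤ.- (+ p)) (sym e) ⟩
    + q ℤ.- + p                ≡⟨ ℤ.m-n≡m⊖n q p ⟩
    q ℤ.⊖ p                    ≡⟨ ℤ.⊖-≥ p≤q ⟩
    + (q ℕ.∸ p)                ∎
    where
    open ≡-Reasoning
    lem : ∀ p x → x ≡ (p ℤ.+ x) ℤ.+ ℤ.- p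
    lem = ℤ-Ring.solve-∀
  -- The bound `∣ det M ∣ ≤ sumℕ s` ensures that no fill is cut short, so different indices give
  -- different totals; this is what makes `w` nonzero.
  sum-at : ∀ k → sumℕ (fill (toℕ {suc ∣ det M ∣} k) s) ≡ toℕ k
  sum-at k = sum-fill (toℕ k) s (ℕ.≤-trans (Fin.toℕ≤pred[n] k) d≤)
  w≢0 : ¬ (∀ k → w k ≡ 0ℤ)
  w≢0 w≡0 = ℕ.<-irrefl (trans (sym (sum-at i)) (trans (sumℕ-cong same) (sum-at j))) i<j
    where
    same : ∀ r → fill (toℕ i) s r ≡ fill (toℕ j) s r
    same r = ℤ.+-injective (sym (trans (eq r) (trans
      (cong (ℤ._+_ (+ fill (toℕ i) s r)) (Σℤ.sum-zero λ c → trans (cong (M r c ℤ.*_) (w≡0 c)) (ℤ.*-zeroʳ (M r c))))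
      (ℤ.+-identityʳ _))))

ℚ-ring : ACR.AlmostCommutativeRing _ _
ℚ-ring = ACR.fromCommutativeRing ℚ.+-*-commutativeRing (λ p → dec⇒maybe (0ℚ ℚ.≟ p))

module Σℚ = FinSum ℚ.+-*-isCommutativeRing sumℚ (λ _ → refl) (λ _ → refl)

-- The embedding ℤ → ℚ

toℚᵘ-ι : ∀ z → toℚᵘ (ι z) ℚᵘ.≃ mkℚᵘ z 0
toℚᵘ-ι z = ℚ.toℚᵘ-fromℚᵘ (mkℚᵘ z 0)

ι-+ : ∀ a b → ι (a ℤ.+ b) ≡ ι a ℚ.+ ι b
ι-+ a b = ℚ.toℚᵘ-injective (begin
  toℚᵘ (ι (a ℤ.+ b))              ≈⟨ toℚᵘ-ι (a ℤ.+ b) ⟩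
  mkℚᵘ (a ℤ.+ b) 0                ≈⟨ *≡* (lem a b) ⟩
  mkℚᵘ a 0 ℚᵘ.+ mkℚᵘ b 0          ≈⟨ ℚᵘ.≃-sym (ℚᵘ.+-cong (toℚᵘ-ι a) (toℚᵘ-ι b)) ⟩
  toℚᵘ (ι a) ℚᵘ.+ toℚᵘ (ι b)      ≈⟨ ℚᵘ.≃-sym (ℚ.toℚᵘ-homo-+ (ι a) (ι b)) ⟩
  toℚᵘ (ι a ℚ.+ ι b)              ∎)
  where
  open ℚᵘ.≃-Reasoning
  lem : ∀ a b → (a ℤ.+ b) ℤ.* 1ℤ ≡ (a ℤ.* 1ℤ ℤ.+ b ℤ.* 1ℤ) ℤ.* 1ℤ
  lem = ℤ-Ring.solve-∀

ι-* : ∀ a b → ι (a ℤ.* b) ≡ ι a ℚ.* ι b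
ι-* a b = ℚ.toℚᵘ-injective (begin
  toℚᵘ (ι (a ℤ.* b))              ≈⟨ toℚᵘ-ι (a ℤ.* b) ⟩
  mkℚᵘ a 0 ℚᵘ.* mkℚᵘ b 0          ≈⟨ ℚᵘ.≃-sym (ℚᵘ.*-cong (toℚᵘ-ι a) (toℚᵘ-ι b)) ⟩
  toℚᵘ (ι a) ℚᵘ.* toℚᵘ (ι b)      ≈⟨ ℚᵘ.≃-sym (ℚ.toℚᵘ-homo-* (ι a) (ι b)) ⟩
  toℚᵘ (ι a ℚ.* ι b)              ∎)
  where open ℚᵘ.≃-Reasoning

ι-injective : ∀ {a b} → ι a ≡ ι b → a ≡ b
ι-injective {a} {b} e with ℚᵘ.≃-trans (ℚᵘ.≃-sym (toℚᵘ-ι a)) (ℚᵘ.≃-trans (ℚ.toℚᵘ-cong e) (toℚᵘ-ι b))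
... | *≡* a≡b = trans (sym (ℤ.*-identityʳ a)) (trans a≡b (ℤ.*-identityʳ b))

ι-mono-≤ : ∀ {a b} → a ℤ.≤ b → ι a ℚ.≤ ι b
ι-mono-≤ {a} {b} a≤b = ℚ.toℚᵘ-cancel-≤ (ℚᵘ.≤-respˡ-≃ (ℚᵘ.≃-sym (toℚᵘ-ι a)) (ℚᵘ.≤-respʳ-≃ (ℚᵘ.≃-sym (toℚᵘ-ι b))
  (ℚᵘ.*≤* (ℤ.*-monoʳ-≤-nonNeg 1ℤ a≤b))))

ι-cancel-≤ : ∀ {a b} → ι a ℚ.≤ ι b → a ℤ.≤ b
ι-cancel-≤ {a} {b} le with ℚᵘ.≤-respˡ-≃ (toℚᵘ-ι a) (ℚᵘ.≤-respʳ-≃ (toℚᵘ-ι b) (ℚ.toℚᵘ-mono-≤ le))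
... | ℚᵘ.*≤* a≤b = subst₂ ℤ._≤_ (ℤ.*-identityʳ a) (ℤ.*-identityʳ b) a≤b

ι-↧-* : ∀ q → ι (↧ q) ℚ.* q ≡ ι (↥ q)
ι-↧-* q@record{} = ℚ.toℚᵘ-injective (begin
  toℚᵘ (ι (↧ q) ℚ.* q)            ≈⟨ ℚ.toℚᵘ-homo-* (ι (↧ q)) q ⟩
  toℚᵘ (ι (↧ q)) ℚᵘ.* toℚᵘ q      ≈⟨ ℚᵘ.*-cong (toℚᵘ-ι (↧ q)) (ℚᵘ.≃-refl {toℚᵘ q}) ⟩
  mkℚᵘ (↧ q) 0 ℚᵘ.* toℚᵘ q        ≈⟨ *≡* (trans (lem (↧ q) (↥ q)) (cong (↥ q ℤ.*_) (sym (ℤ.*-identityˡ (↧ q))))) ⟩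
  mkℚᵘ (↥ q) 0                    ≈⟨ ℚᵘ.≃-sym (toℚᵘ-ι (↥ q)) ⟩
  toℚᵘ (ι (↥ q))                  ∎)
  where
  open ℚᵘ.≃-Reasoning
  lem : ∀ d m → (d ℤ.* m) ℤ.* 1ℤ ≡ m ℤ.* d
  lem = ℤ-Ring.solve-∀

-- `D` is the product of all denominators. This turns the columns of a rational inverse into integer
-- vectors.
clear-denominators : ∀ {n} (q : ℚVec n) → ∃ λ D → D ≢ 0ℤ × Σ (ℤVec n) λ w → ∀ k → ι (w k) ≡ ι D ℚ.* q k
clear-denominators {zero}  q = 1ℤ , (λ ()) , (λ ()) , λ ()
clear-denominators {suc n} q with clear-denominators (q ∘ suc)
... | D , D≢0 , w , e = D ℤ.* ↧ q zero , nonzero , w′ , e′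
  where
  open ≡-Reasoning
  nonzero : D ℤ.* ↧ q zero ≢ 0ℤ
  nonzero p = [ D≢0 , (λ ()) ]′ (ℤ.i*j≡0⇒i≡0∨j≡0 D p)
  w′ : ℤVec (suc n)
  w′ zero    = D ℤ.* ↥ q zero
  w′ (suc k) = ↧ q zero ℤ.* w k
  shuffle : ∀ a b c → a ℚ.* (b ℚ.* c) ≡ b ℚ.* a ℚ.* c
  shuffle = solve-∀ ℚ-ring
  e′ : ∀ k → ι (w′ k) ≡ ι (D ℤ.* ↧ q zero) ℚ.* q k
  e′ zero = begin
    ι (D ℤ.* ↥ q zero)                 ≡⟨ ι-* D (↥ q zero) ⟩
    ι D ℚ.* ι (↥ q zero)               ≡⟨ cong (ι D ℚ.*_) (sym (ι-↧-* (q zero))) ⟩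
    ι D ℚ.* (ι (↧ q zero) ℚ.* q zero)  ≡⟨ sym (ℚ.*-assoc (ι D) (ι (↧ q zero)) (q zero)) ⟩
    ι D ℚ.* ι (↧ q zero) ℚ.* q zero    ≡⟨ cong (ℚ._* q zero) (sym (ι-* D (↧ q zero))) ⟩
    ι (D ℤ.* ↧ q zero) ℚ.* q zero      ∎
  e′ (suc k) = begin
    ι (↧ q zero ℤ.* w k)                    ≡⟨ ι-* (↧ q zero) (w k) ⟩
    ι (↧ q zero) ℚ.* ι (w k)                ≡⟨ cong (ι (↧ q zero) ℚ.*_) (e k) ⟩
    ι (↧ q zero) ℚ.* (ι D ℚ.* q (suc k))    ≡⟨ shuffle (ι (↧ q zero)) (ι D) (q (suc k)) ⟩
    ι D ℚ.* ι (↧ q zero) ℚ.* q (suc k)      ≡⟨ cong (ℚ._* q (suc k)) (sym (ι-* D (↧ q zero))) ⟩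
    ι (D ℤ.* ↧ q zero) ℚ.* q (suc k)        ∎

-- Order and finite sums in ℚ

+-nonneg : ∀ {p q} → 0ℚ ℚ.≤ p → 0ℚ ℚ.≤ q → 0ℚ ℚ.≤ p ℚ.+ q
+-nonneg = ℚ.+-mono-≤

*-nonneg : ∀ {p q} → 0ℚ ℚ.≤ p → 0ℚ ℚ.≤ q → 0ℚ ℚ.≤ p ℚ.* q
*-nonneg {p} {q} 0≤p 0≤q = ℚ.nonNegative⁻¹ _
  {{ℚ.nonNeg*nonNeg⇒nonNeg p {{ℚ.nonNegative 0≤p}} q {{ℚ.nonNegative 0≤q}}}}

*-positive : ∀ {p q} → 0ℚ ℚ.< p → 0ℚ ℚ.< q → 0ℚ ℚ.< p ℚ.* q
*-positive {p} {q} 0<p 0<q = ℚ.positive⁻¹ _ {{ℚ.pos*pos⇒pos p {{ℚ.positive 0<p}} q {{ℚ.positive 0<q}}}}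

reciprocal : ∀ {p} → 0ℚ ℚ.< p → ∃ λ c → 0ℚ ℚ.< c × c ℚ.* p ≡ 1ℚ
reciprocal {p} 0<p = ℚ.1/ p , ℚ.positive⁻¹ _ {{ℚ.1/pos⇒pos p}} , ℚ.*-inverseˡ p
  where
  instance
    pos : ℚ.Positive p
    pos = ℚ.positive 0<p
    nz : ℚ.NonZero p
    nz = ℚ.pos⇒nonZero p

0<1 : 0ℚ ℚ.< 1ℚ
0<1 = ℚ.positive⁻¹ 1ℚ

sub-nonneg : ∀ {p q} → p ℚ.≤ q → 0ℚ ℚ.≤ q ℚ.+ ℚ.- p
sub-nonneg {p} {q} p≤q = subst (ℚ._≤ q ℚ.+ ℚ.- p) (ℚ.+-inverseʳ p) (ℚ.+-monoˡ-≤ (ℚ.- p) p≤q)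

sum-nonneg : ∀ {n} {f : Fin n → ℚ} → (∀ k → 0ℚ ℚ.≤ f k) → 0ℚ ℚ.≤ sumℚ f
sum-nonneg {zero}  e = ℚ.≤-refl
sum-nonneg {suc n} e = +-nonneg (e zero) (sum-nonneg (e ∘ suc))

sum-≥-term : ∀ {n} {f : Fin n → ℚ} → (∀ k → 0ℚ ℚ.≤ f k) → ∀ k → f k ℚ.≤ sumℚ f
sum-≥-term {f = f} e zero    = subst (ℚ._≤ sumℚ f) (ℚ.+-identityʳ _)
  (ℚ.+-monoʳ-≤ (f zero) (sum-nonneg (e ∘ suc)))
sum-≥-term {f = f} e (suc k) = subst (ℚ._≤ sumℚ f) (ℚ.+-identityˡ _) (ℚ.+-mono-≤ (e zero) (sum-≥-term (e ∘ suc) k))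

positive-term : ∀ {n} (f : Fin n → ℚ) → 0ℚ ℚ.< sumℚ f → ∃ λ k → 0ℚ ℚ.< f k
positive-term {zero}  f 0<0 = contradiction 0<0 (ℚ.<-irrefl refl)
positive-term {suc n} f 0<s with 0ℚ ℚ.<? f zero
... | yes 0<f₀ = zero , 0<f₀
... | no  0≮f₀ =
  let k , 0<fₖ = positive-term (f ∘ suc) (ℚ.<-≤-trans 0<s
        (subst (sumℚ f ℚ.≤_) (ℚ.+-identityˡ _) (ℚ.+-monoˡ-≤ (sumℚ (f ∘ suc)) (ℚ.≮⇒≥ 0≮f₀))))
  in suc k , 0<fₖ

dot-cong : ∀ {n} (a : ℤVec n) {x y : ℚVec n} → (∀ k → x k ≡ y k) → dot a x ≡ dot a y
dot-cong a e = Σℚ.sum-cong (λ k → cong (ι (a k) ℚ.*_) (e k))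

dot-+ : ∀ {n} (a : ℤVec n) (x y : ℚVec n) → dot a (λ k → x k ℚ.+ y k) ≡ dot a x ℚ.+ dot a y
dot-+ a x y = trans (Σℚ.sum-cong (λ k → ℚ.*-distribˡ-+ (ι (a k)) (x k) (y k)))
  (Σℚ.sum-+ (λ k → ι (a k) ℚ.* x k) (λ k → ι (a k) ℚ.* y k))

dot-sum : ∀ {m n} (a : ℤVec n) (p : ℚVec m) (x : Fin m → ℚVec n) →
  dot a (λ k → sumℚ (λ i → p i ℚ.* x i k)) ≡ sumℚ (λ i → p i ℚ.* dot a (x i))
dot-sum a p x = begin
  sumℚ (λ k → ι (a k) ℚ.* sumℚ (λ i → p i ℚ.* x i k))     ≡⟨ Σℚ.sum-cong (λ k → sym (Σℚ.sum-* (ι (a k)) (λ i → p i ℚ.* x i k))) ⟩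
  sumℚ (λ k → sumℚ (λ i → ι (a k) ℚ.* (p i ℚ.* x i k)))   ≡⟨ Σℚ.sum-swap (λ k i → ι (a k) ℚ.* (p i ℚ.* x i k)) ⟩
  sumℚ (λ i → sumℚ (λ k → ι (a k) ℚ.* (p i ℚ.* x i k)))   ≡⟨ Σℚ.sum-cong (λ i → trans
                                                                (Σℚ.sum-cong (λ k → shuffle (ι (a k)) (p i) (x i k)))
                                                                (Σℚ.sum-* (p i) (λ k → ι (a k) ℚ.* x i k))) ⟩
  sumℚ (λ i → p i ℚ.* dot a (x i))                        ∎
  where
  open ≡-Reasoning
  shuffle : ∀ a b c → a ℚ.* (b ℚ.* c) ≡ b ℚ.* (a ℚ.* c)
  shuffle = solve-∀ ℚ-ring

dot-* : ∀ {n} (a : ℤVec n) t (x : ℚVec n) → dot a (λ k → t ℚ.* x k) ≡ t ℚ.* dot a x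
dot-* a t x = trans (Σℚ.sum-cong (λ k → shuffle (ι (a k)) t (x k))) (Σℚ.sum-* t (λ k → ι (a k) ℚ.* x k))
  where
  shuffle : ∀ a b c → a ℚ.* (b ℚ.* c) ≡ b ℚ.* (a ℚ.* c)
  shuffle = solve-∀ ℚ-ring

dot-neg : ∀ {n} (a : ℤVec n) (x : ℚVec n) → dot a (λ k → ℚ.- x k) ≡ ℚ.- dot a x
dot-neg a x = trans (dot-cong a (λ k → neg-as-* (x k))) (trans (dot-* a (ℚ.- 1ℚ) x) (sym (neg-as-* (dot a x))))
  where
  neg-as-* : ∀ p → ℚ.- p ≡ (ℚ.- 1ℚ) ℚ.* p
  neg-as-* p = trans (cong ℚ.-_ (sym (ℚ.*-identityˡ p))) (ℚ.neg-distribˡ-* 1ℚ p)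

sum-ι : ∀ {n} (z : ℤVec n) → sumℚ (λ k → ι (z k)) ≡ ι (sumℤ z)
sum-ι {zero}  z = refl
sum-ι {suc n} z = trans (cong (ι (z zero) ℚ.+_) (sum-ι (z ∘ suc))) (sym (ι-+ (z zero) (sumℤ (z ∘ suc))))

dot-ι : ∀ {m n} (M : Matrixℤ m n) (w : ℤVec n) r → dot (M r) (ιv w) ≡ ι ((M · w) r)
dot-ι M w r = trans (Σℚ.sum-cong (λ k → sym (ι-* (M r k) (w k)))) (sum-ι (λ k → M r k ℤ.* w k))

-- Inverse matrices and spanning

δ-diagonal : ∀ {n} (r : Fin n) → δ r r ≡ 1ℚ
δ-diagonal zero    = refl
δ-diagonal (suc r) = δ-diagonal r

δ-off-diagonal : ∀ {n} (r c : Fin n) → r ≢ c → δ r c ≡ 0ℚ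
δ-off-diagonal zero    zero    r≢c = contradiction refl r≢c
δ-off-diagonal zero    (suc c) r≢c = refl
δ-off-diagonal (suc r) zero    r≢c = refl
δ-off-diagonal (suc r) (suc c) r≢c = δ-off-diagonal r c (r≢c ∘ cong suc)

-- Column `r` of `B`, multiplied by a common denominator `D`, is an integer vector whose image is
-- `D` times the `r`-th unit vector.
inverse-spanning : ∀ {n} {M : Matrixℤ n n} {B} → IsInverse M B → Spanning M
inverse-spanning {M = M} {B} inv r with clear-denominators (λ k → B k r)
... | D , D≢0 , w , e = w , (λ s s≢r → ι-injective (trans (image s) (trans (cong (ι D ℚ.*_) (δ-off-diagonal s r s≢r)) (ℚ.*-zeroʳ (ι D)))))
    , λ p → D≢0 (ι-injective (trans (sym (trans (cong (ι D ℚ.*_) (δ-diagonal r)) (ℚ.*-identityʳ (ι D))))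
        (trans (sym (image r)) (cong ι p))))
  where
  image : ∀ s → ι ((M · w) s) ≡ ι D ℚ.* δ s r
  image s = begin
    ι ((M · w) s)                       ≡⟨ sym (dot-ι M w s) ⟩
    dot (M s) (ιv w)                    ≡⟨ dot-cong (M s) e ⟩
    dot (M s) (λ k → ι D ℚ.* B k r)     ≡⟨ dot-* (M s) (ι D) (λ k → B k r) ⟩
    ι D ℚ.* dot (M s) (λ k → B k r)     ≡⟨ cong (ι D ℚ.*_) (inv s r) ⟩
    ι D ℚ.* δ s r                       ∎
    where open ≡-Reasoning

-- Matrices nonnegative off the diagonal

-- Gaussian elimination preserves nonnegativity off the diagonal; the first
-- nonnegative pivot, or the last pivot whatever its sign, yields the weights.
metzler-weights : ∀ m (M : Fin (suc m) → Fin (suc m) → ℚ) → (∀ i j → i ≢ j → 0ℚ ℚ.≤ M i j) →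
  ∃ λ p → (∀ i → 0ℚ ℚ.≤ p i) × (∃ λ i → 0ℚ ℚ.< p i) ×
    ((∀ j → 0ℚ ℚ.≤ sumℚ (λ i → p i ℚ.* M i j)) ⊎ (∀ j → sumℚ (λ i → p i ℚ.* M i j) ℚ.≤ 0ℚ))
metzler-weights m M off with 0ℚ ℚ.≤? M zero zero
-- With a nonnegative pivot the whole first row is nonnegative, so the first unit vector serves.
metzler-weights m M off | yes 0≤M₀₀ = p , p≥0 , (zero , 0<1) , inj₁ λ j → subst (0ℚ ℚ.≤_) (sym (pM j)) (row≥0 j)
  where
  p : Fin (suc m) → ℚ
  p zero    = 1ℚ
  p (suc _) = 0ℚ
  p≥0 : ∀ i → 0ℚ ℚ.≤ p i
  p≥0 zero    = ℚ.<⇒≤ 0<1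
  p≥0 (suc _) = ℚ.≤-refl
  row≥0 : ∀ j → 0ℚ ℚ.≤ M zero j
  row≥0 zero    = 0≤M₀₀
  row≥0 (suc j) = off zero (suc j) λ ()
  pM : ∀ j → sumℚ (λ i → p i ℚ.* M i j) ≡ M zero j
  pM j = trans (cong₂ ℚ._+_ (ℚ.*-identityˡ (M zero j)) (Σℚ.sum-zero (λ i → ℚ.*-zeroˡ (M (suc i) j))))
    (ℚ.+-identityʳ (M zero j))
metzler-weights zero M off | no 0≰M₀₀ = (λ _ → 1ℚ) , (λ _ → ℚ.<⇒≤ 0<1) , (zero , 0<1) , inj₂ λ { zero →
  subst (ℚ._≤ 0ℚ) (sym (trans (ℚ.+-identityʳ _) (ℚ.*-identityˡ (M zero zero)))) (ℚ.<⇒≤ (ℚ.≰⇒> 0≰M₀₀)) }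
metzler-weights (suc m) M off | no 0≰M₀₀ with reciprocal (ℚ.neg-antimono-< (ℚ.≰⇒> 0≰M₀₀))
... | c , 0<c , c*-M₀₀≡1 with metzler-weights m M′ off′
  where
  -- The Schur complement of the negative pivot, where `c = -1 / M zero zero` is positive; the
  -- correction is a product of nonnegative factors.
  M′ : Fin (suc m) → Fin (suc m) → ℚ
  M′ i j = M (suc i) (suc j) ℚ.+ M (suc i) zero ℚ.* (c ℚ.* M zero (suc j))
  off′ : ∀ i j → i ≢ j → 0ℚ ℚ.≤ M′ i j
  off′ i j i≢j = +-nonneg (off (suc i) (suc j) (i≢j ∘ Fin.suc-injective))
    (*-nonneg (off (suc i) zero λ ()) (*-nonneg (ℚ.<⇒≤ 0<c) (off zero (suc j) λ ())))
... | p′ , p′≥0 , (i₀ , p′>0) , sign = p , p≥0 , (suc i₀ , p′>0) , transfer sign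
  where
  s : ℚ
  s = sumℚ (λ i → p′ i ℚ.* M (suc i) zero)
  -- The first weight is chosen so that column zero of the combination vanishes; on the other
  -- columns the combination then agrees with that of the Schur complement.
  p : Fin (suc (suc m)) → ℚ
  p zero    = c ℚ.* s
  p (suc i) = p′ i
  p≥0 : ∀ i → 0ℚ ℚ.≤ p i
  p≥0 zero    = *-nonneg (ℚ.<⇒≤ 0<c) (sum-nonneg (λ i → *-nonneg (p′≥0 i) (off (suc i) zero λ ())))
  p≥0 (suc i) = p′≥0 i
  open ≡-Reasoning
  pM₀ : sumℚ (λ i → p i ℚ.* M i zero) ≡ 0ℚ
  pM₀ = begin
    c ℚ.* s ℚ.* M zero zero ℚ.+ s             ≡⟨ lem c s (M zero zero) ⟩
    (ℚ.- (c ℚ.* (ℚ.- M zero zero)) ℚ.+ 1ℚ) ℚ.* s ≡⟨ cong (λ u → (ℚ.- u ℚ.+ 1ℚ) ℚ.* s) c*-M₀₀≡1 ⟩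
    (ℚ.- 1ℚ ℚ.+ 1ℚ) ℚ.* s                     ≡⟨ ℚ.*-zeroˡ s ⟩
    0ℚ                                        ∎
    where
    lem : ∀ c s a → c ℚ.* s ℚ.* a ℚ.+ s ≡ (ℚ.- (c ℚ.* (ℚ.- a)) ℚ.+ 1ℚ) ℚ.* s
    lem = solve-∀ ℚ-ring
  pMₛ : ∀ j → sumℚ (λ i → p′ i ℚ.* (M (suc i) (suc j) ℚ.+ M (suc i) zero ℚ.* (c ℚ.* M zero (suc j))))
    ≡ sumℚ (λ i → p i ℚ.* M i (suc j))
  pMₛ j = begin
    sumℚ (λ i → p′ i ℚ.* (M (suc i) (suc j) ℚ.+ M (suc i) zero ℚ.* d))            ≡⟨ Σℚ.sum-cong (λ i → expand (p′ i) (M (suc i) (suc j)) (M (suc i) zero) d) ⟩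
    sumℚ (λ i → d ℚ.* (p′ i ℚ.* M (suc i) zero) ℚ.+ p′ i ℚ.* M (suc i) (suc j))   ≡⟨ Σℚ.sum-+ (λ i → d ℚ.* (p′ i ℚ.* M (suc i) zero)) (λ i → p′ i ℚ.* M (suc i) (suc j)) ⟩
    sumℚ (λ i → d ℚ.* (p′ i ℚ.* M (suc i) zero)) ℚ.+ t                            ≡⟨ cong (ℚ._+ t) (Σℚ.sum-* d (λ i → p′ i ℚ.* M (suc i) zero)) ⟩
    d ℚ.* s ℚ.+ t                                                                 ≡⟨ cong (ℚ._+ t) (shuffle c (M zero (suc j)) s) ⟩
    c ℚ.* s ℚ.* M zero (suc j) ℚ.+ t                                              ∎
    where
    d t : ℚ
    d = c ℚ.* M zero (suc j)
    t = sumℚ (λ i → p′ i ℚ.* M (suc i) (suc j))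
    expand : ∀ p a b d → p ℚ.* (a ℚ.+ b ℚ.* d) ≡ d ℚ.* (p ℚ.* b) ℚ.+ p ℚ.* a
    expand = solve-∀ ℚ-ring
    shuffle : ∀ c a s → c ℚ.* a ℚ.* s ≡ c ℚ.* s ℚ.* a
    shuffle = solve-∀ ℚ-ring
  transfer : _ → (∀ j → 0ℚ ℚ.≤ sumℚ (λ i → p i ℚ.* M i j)) ⊎ (∀ j → sumℚ (λ i → p i ℚ.* M i j) ℚ.≤ 0ℚ)
  transfer (inj₁ p′M′≥0) = inj₁ λ { zero → ℚ.≤-reflexive (sym pM₀) ; (suc j) → subst (0ℚ ℚ.≤_) (pMₛ j) (p′M′≥0 j) }
  transfer (inj₂ p′M′≤0) = inj₂ λ { zero → ℚ.≤-reflexive pM₀ ; (suc j) → subst (ℚ._≤ 0ℚ) (pMₛ j) (p′M′≤0 j) }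

-- Bounded polyhedra

escape : ∀ {a y M} → a ℚ.≤ M → 0ℚ ℚ.< y → ∃ λ τ → 0ℚ ℚ.≤ τ × M ℚ.< a ℚ.+ τ ℚ.* y
escape {a} {y} {M} a≤M 0<y with reciprocal 0<y
... | c , 0<c , c*y≡1 = τ , *-nonneg (+-nonneg (sub-nonneg a≤M) (ℚ.<⇒≤ 0<1)) (ℚ.<⇒≤ 0<c)
    , subst₂ ℚ._<_ (ℚ.+-identityʳ M) (sym value) (ℚ.+-monoʳ-< M 0<1)
  where
  -- The added 1 makes the overshoot strict: the value reached is `M + 1`.
  τ : ℚ
  τ = (M ℚ.+ ℚ.- a ℚ.+ 1ℚ) ℚ.* c
  value : a ℚ.+ τ ℚ.* y ≡ M ℚ.+ 1ℚ
  value = begin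
    a ℚ.+ τ ℚ.* y                                     ≡⟨ cong (a ℚ.+_) (ℚ.*-assoc (M ℚ.+ ℚ.- a ℚ.+ 1ℚ) c y) ⟩
    a ℚ.+ (M ℚ.+ ℚ.- a ℚ.+ 1ℚ) ℚ.* (c ℚ.* y)          ≡⟨ cong (λ u → a ℚ.+ (M ℚ.+ ℚ.- a ℚ.+ 1ℚ) ℚ.* u) c*y≡1 ⟩
    a ℚ.+ (M ℚ.+ ℚ.- a ℚ.+ 1ℚ) ℚ.* 1ℚ                 ≡⟨ lem a M ⟩
    M ℚ.+ 1ℚ                                          ∎
    where
    open ≡-Reasoning
    lem : ∀ a M → a ℚ.+ (M ℚ.+ ℚ.- a ℚ.+ 1ℚ) ℚ.* 1ℚ ≡ M ℚ.+ 1ℚ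
    lem = solve-∀ ℚ-ring


punchIn-cover : ∀ {n} {P : Fin (suc n) → Set} i → P i → (∀ r → P (punchIn i r)) → ∀ j → P j
punchIn-cover {P = P} i Pᵢ Pᵣ j with i Fin.≟ j
... | yes refl = Pᵢ
... | no  i≢j  = subst P (Fin.punchIn-punchOut i≢j) (Pᵣ (punchOut i≢j))

module BoundedPolyhedron {m n} (A : Matrixℤ m n) (b : ℤVec m) (bounded : Bounded A b)
  (x : ℚVec n) (x∈S : InPoly A b x) where

  ray : ∀ {y τ} → (∀ j → dot (A j) y ℚ.≤ 0ℚ) → 0ℚ ℚ.≤ τ → InPoly A b (λ k → x k ℚ.+ τ ℚ.* y k)
  ray {y} {τ} Ay≤0 0≤τ j = begin
    dot (A j) (λ k → x k ℚ.+ τ ℚ.* y k)            ≡⟨ dot-+ (A j) x (λ k → τ ℚ.* y k) ⟩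
    dot (A j) x ℚ.+ dot (A j) (λ k → τ ℚ.* y k)    ≡⟨ cong (dot (A j) x ℚ.+_) (dot-* (A j) τ y) ⟩
    dot (A j) x ℚ.+ τ ℚ.* dot (A j) y              ≤⟨ ℚ.+-mono-≤ (x∈S j) (ℚ.*-monoˡ-≤-nonNeg τ {{ℚ.nonNegative 0≤τ}} (Ay≤0 j)) ⟩
    ι (b j) ℚ.+ τ ℚ.* 0ℚ                           ≡⟨ trans (cong (ι (b j) ℚ.+_) (ℚ.*-zeroʳ τ)) (ℚ.+-identityʳ (ι (b j))) ⟩
    ι (b j)                                        ∎
    where open ℚ.≤-Reasoning

  -- A nonzero entry of `y` would carry the ray from `x` along `y`, which stays in the polyhedron,
  -- past the bound `M` or `- M`.
  recession-≤ : ∀ {y} → (∀ j → dot (A j) y ℚ.≤ 0ℚ) → ∀ k → y k ≡ 0ℚ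
  recession-≤ {y} Ay≤0 k with ℚ.<-cmp (y k) 0ℚ
  ... | tri≈ _ y≡0 _ = y≡0
  ... | tri> _ _ 0<y =
    let τ , 0≤τ , M< = escape (proj₂ (proj₂ bounded x x∈S k)) 0<y
    in contradiction (ℚ.<-≤-trans M< (proj₂ (proj₂ bounded _ (ray Ay≤0 0≤τ) k))) (ℚ.<-irrefl refl)
  ... | tri< y<0 _ _ =
    let M = proj₁ bounded
        τ , 0≤τ , M< = escape (flip (proj₁ (proj₂ bounded x x∈S k))) (ℚ.neg-antimono-< y<0)
    in contradiction
         (ℚ.<-≤-trans M< (subst (ℚ._≤ M) (negate (x k) τ (y k)) (flip (proj₁ (proj₂ bounded _ (ray Ay≤0 0≤τ) k)))))
         (ℚ.<-irrefl refl)
    where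
    flip : ∀ {M p} → ℚ.- M ℚ.≤ p → ℚ.- p ℚ.≤ M
    flip {M} {p} -M≤p = subst (ℚ.- p ℚ.≤_) (ℚ-neg-involutive M) (ℚ.neg-antimono-≤ -M≤p)
    negate : ∀ a t c → ℚ.- (a ℚ.+ t ℚ.* c) ≡ ℚ.- a ℚ.+ t ℚ.* (ℚ.- c)
    negate = solve-∀ ℚ-ring

  recession-≥ : ∀ {y} → (∀ j → 0ℚ ℚ.≤ dot (A j) y) → ∀ k → y k ≡ 0ℚ
  recession-≥ {y} Ay≥0 k = ℚ.neg-injective (recession-≤ {λ k → ℚ.- y k}
    (λ j → subst (ℚ._≤ 0ℚ) (sym (dot-neg (A j) y)) (ℚ.neg-antimono-≤ (Ay≥0 j))) k)

module BoundedSimplex {n} (A : Matrixℤ (suc n) n) (b : ℤVec (suc n)) (bounded : Bounded A b)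
  (x : ℚVec n) (x∈S : InPoly A b x) where

  open BoundedPolyhedron A b bounded x x∈S public

  -- Whatever sign row `i` takes on `y`, all rows share one weak sign there, so `y` or its negative
  -- is a recession direction.
  delRow-kernel : ∀ i {y} → (∀ r → dot (delRow i A r) y ≡ 0ℚ) → ∀ k → y k ≡ 0ℚ
  delRow-kernel i {y} Ay≡0 with ℚ.≤-total (dot (A i) y) 0ℚ
  ... | inj₁ ≤0 = recession-≤ (punchIn-cover i ≤0 (λ r → ℚ.≤-reflexive (Ay≡0 r)))
  ... | inj₂ 0≤ = recession-≥ (punchIn-cover i 0≤ (λ r → ℚ.≤-reflexive (sym (Ay≡0 r))))

  -- Otherwise all rows would be nonnegative on `y`, and boundedness would force `y` to vanish.
  remaining-row-negative : ∀ i {y} → (∀ r → 0ℚ ℚ.≤ dot (delRow i A r) y) → ¬ (∀ k → y k ≡ 0ℚ) → dot (A i) y ℚ.< 0ℚ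
  remaining-row-negative i Ay≥0 y≢0 = ℚ.≰⇒> λ 0≤ → y≢0 (recession-≥ (punchIn-cover i 0≤ Ay≥0))

  -- The hypothesis only provides a right inverse; boundedness makes it two-sided.
  left-inverse : ∀ i {B} → IsInverse (delRow i A) B → ∀ (y : ℚVec n) k →
    y k ≡ sumℚ (λ s → B k s ℚ.* dot (delRow i A s) y)
  -- The difference of the two sides lies in the kernel of the remaining rows.
  left-inverse i {B} inv y k = difference (delRow-kernel i {λ k → y k ℚ.+ ℚ.- Bβ k} same k)
    where
    β Bβ : ℚVec n
    β s  = dot (delRow i A s) y
    Bβ k = sumℚ (λ s → B k s ℚ.* β s)
    difference : ∀ {p q} → p ℚ.+ ℚ.- q ≡ 0ℚ → p ≡ q
    difference {p} {q} e = trans (lem p q) (trans (cong (ℚ._+ q) e) (ℚ.+-identityˡ q))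
      where
      lem : ∀ p q → p ≡ p ℚ.+ ℚ.- q ℚ.+ q
      lem = solve-∀ ℚ-ring
    dot-Bβ : ∀ r → dot (delRow i A r) Bβ ≡ β r
    dot-Bβ r = begin
      dot (delRow i A r) Bβ                                        ≡⟨ dot-cong (delRow i A r) (λ k → Σℚ.sum-cong (λ s → ℚ.*-comm (B k s) (β s))) ⟩
      dot (delRow i A r) (λ k → sumℚ (λ s → β s ℚ.* B k s))        ≡⟨ dot-sum (delRow i A r) β (λ s k → B k s) ⟩
      sumℚ (λ s → β s ℚ.* dot (delRow i A r) (λ k → B k s))        ≡⟨ Σℚ.sum-cong (λ s → cong (β s ℚ.*_) (inv r s)) ⟩
      sumℚ (λ s → β s ℚ.* δ r s)                                   ≡⟨ Σℚ.sum-single {f = λ s → β s ℚ.* δ r s} r (λ s s≢r →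
                                                                         trans (cong (β s ℚ.*_) (δ-off-diagonal r s (s≢r ∘ sym))) (ℚ.*-zeroʳ (β s))) ⟩
      β r ℚ.* δ r r                                                ≡⟨ trans (cong (β r ℚ.*_) (δ-diagonal r)) (ℚ.*-identityʳ (β r)) ⟩
      β r                                                          ∎
      where open ≡-Reasoning
    same : ∀ r → dot (delRow i A r) (λ k → y k ℚ.+ ℚ.- Bβ k) ≡ 0ℚ
    same r = begin
      dot (delRow i A r) (λ k → y k ℚ.+ ℚ.- Bβ k)                  ≡⟨ dot-+ (delRow i A r) y (λ k → ℚ.- Bβ k) ⟩
      β r ℚ.+ dot (delRow i A r) (λ k → ℚ.- Bβ k)                  ≡⟨ cong (β r ℚ.+_) (trans (dot-neg (delRow i A r) Bβ) (cong ℚ.-_ (dot-Bβ r))) ⟩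
      β r ℚ.+ ℚ.- β r                                              ≡⟨ ℚ.+-inverseʳ (β r) ⟩
      0ℚ                                                           ∎
      where open ≡-Reasoning

-- Vertices of the integer hull

-- Moving half of the weight of z t to one side exhibits v as a proper
-- convex combination of z t and another point of the hull.
vertex-point : ∀ {n} {A : Matrixℤ (suc n) n} {b v} → IsVertex (InIntHull A b) v →
  ∀ {k} (z : Fin k → ℤVec n) → (∀ t → InPoly A b (ιv (z t))) →
  (conv : InConv (λ t → ιv (z t)) v) → ∀ t → 0ℚ ℚ.< proj₁ conv t → ∀ c → ι (z t c) ≡ v c
vertex-point {n} {A} {b} {v} (_ , extreme) {k} z z∈S (λs , λs≥0 , Σλs≡1 , v≡) t 0<λt =
  proj₁ (extreme (ιv (z t)) w h y-in w-in 0<h h<1 split)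
  where
  open ≡-Reasoning
  -- Half of the weight stays strictly below 1 even if the whole weight sits on `z t`.
  h : ℚ
  h = λs t ℚ.* ½
  0<h : 0ℚ ℚ.< h
  0<h = *-positive 0<λt (ℚ.positive⁻¹ ½)
  h<1 : h ℚ.< 1ℚ
  h<1 = ℚ.≤-<-trans (ℚ.*-monoʳ-≤-nonNeg ½ (subst (λs t ℚ.≤_) Σλs≡1 (sum-≥-term λs≥0 t))) (from-yes (1ℚ ℚ.* ½ ℚ.<? 1ℚ))
  rest : ∃ λ c → 0ℚ ℚ.< c × c ℚ.* (1ℚ ℚ.- h) ≡ 1ℚ
  rest = reciprocal (subst (ℚ._< 1ℚ ℚ.- h) (ℚ.+-inverseʳ h) (ℚ.+-monoˡ-< (ℚ.- h) h<1))
  c₀ : ℚ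
  c₀ = proj₁ rest
  -- `κ` is what remains of the weights, of total `1 - h`; `μ` rescales it to total 1.
  κ μ : Fin k → ℚ
  κ = updateAt λs t (ℚ._* ½)
  μ s = c₀ ℚ.* κ s
  κ≥0 : ∀ s → 0ℚ ℚ.≤ κ s
  κ≥0 s with s Fin.≟ t
  ... | yes refl = subst (0ℚ ℚ.≤_) (sym (updateAt-updates s λs)) (ℚ.<⇒≤ 0<h)
  ... | no s≢t   = subst (0ℚ ℚ.≤_) (sym (updateAt-minimal s t λs s≢t)) (λs≥0 s)
  halves : ∀ a → a ≡ a ℚ.* ½ ℚ.+ a ℚ.* ½
  halves a = trans (sym (ℚ.*-identityʳ a)) (ℚ.*-distribˡ-+ a ½ ½)
  moved : ∀ (f : Fin k → ℚ) → sumℚ (λ s → λs s ℚ.* f s) ≡ sumℚ (λ s → κ s ℚ.* f s) ℚ.+ h ℚ.* f t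
  moved f = Σℚ.sum-differ t (h ℚ.* f t)
    (λ s s≢t → cong (ℚ._* f s) (sym (updateAt-minimal s t λs s≢t)))
    (trans (cong (ℚ._* f t) (halves (λs t))) (trans (ℚ.*-distribʳ-+ (f t) h h)
      (cong (λ u → u ℚ.* f t ℚ.+ h ℚ.* f t) (sym (updateAt-updates t λs)))))
  Σκ : sumℚ κ ≡ 1ℚ ℚ.- h
  Σκ = begin
    sumℚ κ                                          ≡⟨ Σℚ.sum-cong (λ s → sym (ℚ.*-identityʳ (κ s))) ⟩
    sumℚ (λ s → κ s ℚ.* 1ℚ)                         ≡⟨ lem _ (h ℚ.* 1ℚ) ⟩
    sumℚ (λ s → κ s ℚ.* 1ℚ) ℚ.+ h ℚ.* 1ℚ ℚ.- h ℚ.* 1ℚ ≡⟨ cong₂ ℚ._-_ (sym (moved (λ _ → 1ℚ))) (ℚ.*-identityʳ h) ⟩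
    sumℚ (λ s → λs s ℚ.* 1ℚ) ℚ.- h                  ≡⟨ cong (ℚ._- h) (trans (Σℚ.sum-cong (λ s → ℚ.*-identityʳ (λs s))) Σλs≡1) ⟩
    1ℚ ℚ.- h                                        ∎
    where
    lem : ∀ p q → p ≡ p ℚ.+ q ℚ.+ ℚ.- q
    lem = solve-∀ ℚ-ring
  w : ℚVec n
  w c = sumℚ (λ s → μ s ℚ.* ι (z s c))
  w-in : InIntHull A b w
  w-in = k , z , z∈S , μ , (λ s → *-nonneg (ℚ.<⇒≤ (proj₁ (proj₂ rest))) (κ≥0 s))
    , trans (Σℚ.sum-* c₀ κ) (trans (cong (c₀ ℚ.*_) Σκ) (proj₂ (proj₂ rest))) , λ _ → refl
  y-in : InIntHull A b (ιv (z t))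
  y-in = 1 , (λ _ → z t) , (λ _ → z∈S t) , (λ _ → 1ℚ) , (λ _ → ℚ.<⇒≤ 0<1) , refl
    , λ c → sym (trans (ℚ.+-identityʳ _) (ℚ.*-identityˡ (ι (z t c))))
  split : ∀ c → v c ≡ h ℚ.* ι (z t c) ℚ.+ (1ℚ ℚ.- h) ℚ.* w c
  split c = begin
    v c                                                           ≡⟨ v≡ c ⟩
    sumℚ (λ s → λs s ℚ.* ι (z s c))                               ≡⟨ moved (λ s → ι (z s c)) ⟩
    K ℚ.+ h ℚ.* ι (z t c)                                         ≡⟨ ℚ.+-comm K (h ℚ.* ι (z t c)) ⟩
    h ℚ.* ι (z t c) ℚ.+ K                                         ≡⟨ cong (h ℚ.* ι (z t c) ℚ.+_) (sym K≡) ⟩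
    h ℚ.* ι (z t c) ℚ.+ (1ℚ ℚ.- h) ℚ.* w c                        ∎
    where
    K : ℚ
    K = sumℚ (λ s → κ s ℚ.* ι (z s c))
    K≡ : (1ℚ ℚ.- h) ℚ.* w c ≡ K
    K≡ = begin
      (1ℚ ℚ.- h) ℚ.* w c                   ≡⟨ cong ((1ℚ ℚ.- h) ℚ.*_) (trans (Σℚ.sum-cong (λ s → ℚ.*-assoc c₀ (κ s) (ι (z s c))))
                                                (Σℚ.sum-* c₀ (λ s → κ s ℚ.* ι (z s c)))) ⟩
      (1ℚ ℚ.- h) ℚ.* (c₀ ℚ.* K)            ≡⟨ lem (1ℚ ℚ.- h) c₀ K ⟩
      c₀ ℚ.* (1ℚ ℚ.- h) ℚ.* K              ≡⟨ cong (ℚ._* K) (proj₂ (proj₂ rest)) ⟩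
      1ℚ ℚ.* K                             ≡⟨ ℚ.*-identityˡ K ⟩
      K                                    ∎
      where
      lem : ∀ a c k → a ℚ.* (c ℚ.* k) ≡ c ℚ.* a ℚ.* k
      lem = solve-∀ ℚ-ring

-- Slacks and the simplices `S_i`

sum-ι-ℕ : ∀ {n} (s : Fin n → ℕ) → sumℚ (λ r → ι (+ s r)) ≡ ι (+ sumℕ s)
sum-ι-ℕ {zero}  s = refl
sum-ι-ℕ {suc n} s = trans (cong (ι (+ s zero) ℚ.+_) (sum-ι-ℕ (s ∘ suc))) (sym (ι-+ (+ s zero) (+ sumℕ (s ∘ suc))))

term-≤-sumℕ : ∀ {n} (s : Fin n → ℕ) r → s r ℕ.≤ sumℕ s
term-≤-sumℕ s zero    = ℕ.m≤m+n (s zero) _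
term-≤-sumℕ s (suc r) = ℕ.m≤n⇒m≤o+n (s zero) (term-≤-sumℕ (s ∘ suc) r)

-- e = 1/D, except that any e will do if D = 0
scale : ∀ D → ∃ λ e → 0ℚ ℚ.≤ e × (∀ m → m ℕ.≤ D → e ℚ.* ι (+ m) ℚ.≤ 1ℚ × ι (+ D) ℚ.* (e ℚ.* ι (+ m)) ≡ ι (+ m))
scale zero    = 0ℚ , ℚ.≤-refl , λ { zero z≤n → ℚ.<⇒≤ 0<1 , refl }
scale (suc D) with reciprocal {ι (+ suc D)} (ℚ.≰⇒> λ p → contradiction (ι-cancel-≤ {+ suc D} {0ℤ} p) λ { (ℤ.+≤+ ()) })
... | e , 0<e , e*D≡1 = e , ℚ.<⇒≤ 0<e , λ m m≤D →
  subst (e ℚ.* ι (+ m) ℚ.≤_) e*D≡1 (ℚ.*-monoˡ-≤-nonNeg e {{ℚ.nonNegative (ℚ.<⇒≤ 0<e)}} (ι-mono-≤ (ℤ.+≤+ m≤D)))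
  , trans (lem (ι (+ suc D)) e (ι (+ m))) (trans (cong (ℚ._* ι (+ m)) e*D≡1) (ℚ.*-identityˡ (ι (+ m))))
  where
  lem : ∀ d e m → d ℚ.* (e ℚ.* m) ≡ e ℚ.* d ℚ.* m
  lem = solve-∀ ℚ-ring

-- Point `suc r` receives the weight `σ r / (Δ - 1)` and the apex `mulMV B β` the remainder, which
-- is nonnegative by the bound on `sumℕ σ`. If `Δ - 1` is zero, all `σ r` vanish and the full weight
-- is on the apex.
conv-SiPoints : ∀ {n} Δ (B : Fin n → Fin n → ℚ) (β : ℤVec n) (σ : Fin n → ℕ) → sumℕ σ ℕ.≤ Δ ℕ.∸ 1 →
  ∀ {x} → (∀ k → x k ≡ mulMV B β k ℚ.+ ℚ.- sumℚ (λ r → B k r ℚ.* ι (+ σ r))) → InConv (SiPoints Δ B β) x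
conv-SiPoints {n} Δ B β σ Σσ≤D {x} x≡ with scale (Δ ℕ.∸ 1)
... | e , 0≤e , scaled = λs , λs≥0 , Σλs≡1 , λ k → trans (x≡ k) (sym (combination k))
  where
  open ≡-Reasoning
  D s : ℚ
  D = ι (+ (Δ ℕ.∸ 1))
  s = sumℚ (λ r → e ℚ.* ι (+ σ r))
  s≡ : s ≡ e ℚ.* ι (+ sumℕ σ)
  s≡ = trans (Σℚ.sum-* e (λ r → ι (+ σ r))) (cong (e ℚ.*_) (sum-ι-ℕ σ))
  λs : Fin (suc n) → ℚ
  λs zero    = 1ℚ ℚ.+ ℚ.- s
  λs (suc r) = e ℚ.* ι (+ σ r)
  λs≥0 : ∀ t → 0ℚ ℚ.≤ λs t
  λs≥0 zero    = sub-nonneg (subst (ℚ._≤ 1ℚ) (sym s≡) (proj₁ (scaled (sumℕ σ) Σσ≤D)))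
  λs≥0 (suc r) = *-nonneg 0≤e (ι-mono-≤ {0ℤ} {+ σ r} (ℤ.+≤+ z≤n))
  Σλs≡1 : 1ℚ ℚ.+ ℚ.- s ℚ.+ s ≡ 1ℚ
  Σλs≡1 = lem 1ℚ s
    where
    lem : ∀ p q → p ℚ.+ ℚ.- q ℚ.+ q ≡ p
    lem = solve-∀ ℚ-ring
  combination : ∀ k → sumℚ (λ t → λs t ℚ.* SiPoints Δ B β t k)
    ≡ mulMV B β k ℚ.+ ℚ.- sumℚ (λ r → B k r ℚ.* ι (+ σ r))
  combination k = begin
    (1ℚ ℚ.+ ℚ.- s) ℚ.* u ℚ.+ sumℚ (λ r → e ℚ.* ι (+ σ r) ℚ.* (u ℚ.- D ℚ.* B k r))
      ≡⟨ cong ((1ℚ ℚ.+ ℚ.- s) ℚ.* u ℚ.+_) (trans (Σℚ.sum-cong term)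
           (trans (Σℚ.sum-+ (λ r → u ℚ.* (e ℚ.* ι (+ σ r))) (λ r → (ℚ.- 1ℚ) ℚ.* (B k r ℚ.* ι (+ σ r))))
             (cong₂ ℚ._+_ (Σℚ.sum-* u (λ r → e ℚ.* ι (+ σ r))) (Σℚ.sum-* (ℚ.- 1ℚ) (λ r → B k r ℚ.* ι (+ σ r)))))) ⟩
    (1ℚ ℚ.+ ℚ.- s) ℚ.* u ℚ.+ (u ℚ.* s ℚ.+ (ℚ.- 1ℚ) ℚ.* q)
      ≡⟨ collect s u q ⟩
    u ℚ.+ ℚ.- q
      ∎
    where
    u q : ℚ
    u = mulMV B β k
    q = sumℚ (λ r → B k r ℚ.* ι (+ σ r))
    collect : ∀ s u q → (1ℚ ℚ.+ ℚ.- s) ℚ.* u ℚ.+ (u ℚ.* s ℚ.+ (ℚ.- 1ℚ) ℚ.* q) ≡ u ℚ.+ ℚ.- q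
    collect = solve-∀ ℚ-ring
    expand : ∀ l u d c → l ℚ.* (u ℚ.+ ℚ.- (d ℚ.* c)) ≡ u ℚ.* l ℚ.+ (ℚ.- 1ℚ) ℚ.* (c ℚ.* (d ℚ.* l))
    expand = solve-∀ ℚ-ring
    term : ∀ r → e ℚ.* ι (+ σ r) ℚ.* (u ℚ.- D ℚ.* B k r)
      ≡ u ℚ.* (e ℚ.* ι (+ σ r)) ℚ.+ (ℚ.- 1ℚ) ℚ.* (B k r ℚ.* ι (+ σ r))
    term r = trans (expand (e ℚ.* ι (+ σ r)) u D (B k r))
      (cong (λ m → u ℚ.* (e ℚ.* ι (+ σ r)) ℚ.+ (ℚ.- 1ℚ) ℚ.* (B k r ℚ.* m))
        (proj₂ (scaled (σ r) (ℕ.≤-trans (term-≤-sumℕ σ r) Σσ≤D))))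

-- The absolute value keeps slacks in ℕ; for points of the polyhedron it changes nothing, as
-- `slack-≡` records.
slack : ∀ {m n} → Matrixℤ m n → ℤVec m → ℤVec n → Fin m → ℕ
slack A b z j = ∣ b j ℤ.- (A · z) j ∣

slack-≡ : ∀ {m n} (A : Matrixℤ m n) b z → InPoly A b (ιv z) → ∀ j →
  dot (A j) (ιv z) ≡ ι (b j) ℚ.+ (ℚ.- 1ℚ) ℚ.* ι (+ slack A b z j)
slack-≡ A b z z∈S j = begin
  dot (A j) (ιv z)                                            ≡⟨ dot-ι A z j ⟩
  ι ((A · z) j)                                               ≡⟨ lem (ι (b j)) (ι ((A · z) j)) ⟩
  ι (b j) ℚ.+ (ℚ.- 1ℚ) ℚ.* (ι (b j) ℚ.+ (ℚ.- 1ℚ) ℚ.* ι ((A · z) j)) ≡⟨ cong (λ u → ι (b j) ℚ.+ (ℚ.- 1ℚ) ℚ.* u) (sym ι-slack) ⟩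
  ι (b j) ℚ.+ (ℚ.- 1ℚ) ℚ.* ι (+ slack A b z j)                ∎
  where
  open ≡-Reasoning
  lem : ∀ p q → q ≡ p ℚ.+ (ℚ.- 1ℚ) ℚ.* (p ℚ.+ (ℚ.- 1ℚ) ℚ.* q)
  lem = solve-∀ ℚ-ring
  neg-as-* : ∀ p → ℤ.- p ≡ ℤ.-1ℤ ℤ.* p
  neg-as-* = ℤ-Ring.solve-∀
  Az≤b : (A · z) j ℤ.≤ b j
  Az≤b = ι-cancel-≤ (subst (ℚ._≤ ι (b j)) (dot-ι A z j) (z∈S j))
  ι-slack : ι (+ slack A b z j) ≡ ι (b j) ℚ.+ (ℚ.- 1ℚ) ℚ.* ι ((A · z) j)
  ι-slack = begin
    ι (+ slack A b z j)                        ≡⟨ cong ι (ℤ.0≤i⇒+∣i∣≡i (ℤ.i≤j⇒0≤j-i Az≤b)) ⟩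
    ι (b j ℤ.- (A · z) j)                      ≡⟨ ι-+ (b j) (ℤ.- (A · z) j) ⟩
    ι (b j) ℚ.+ ι (ℤ.- (A · z) j)              ≡⟨ cong (λ u → ι (b j) ℚ.+ ι u) (neg-as-* ((A · z) j)) ⟩
    ι (b j) ℚ.+ ι (ℤ.-1ℤ ℤ.* (A · z) j)        ≡⟨ cong (ι (b j) ℚ.+_) (ι-* ℤ.-1ℤ ((A · z) j)) ⟩
    ι (b j) ℚ.+ (ℚ.- 1ℚ) ℚ.* ι ((A · z) j)     ∎

-- Integral points of the simplex

module IntegerPoint {n} (A : Matrixℤ (suc n) n) (b : ℤVec (suc n)) (bounded : Bounded A b)
  (z : ℤVec n) (z∈S : InPoly A b (ιv z)) where

  open BoundedSimplex A b bounded (ιv z) z∈S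

  -- Since `A_i z` is `b^(i)` minus the slacks, applying the inverse writes `z` as `u_i` minus the
  -- combination of its columns with the slacks as coefficients.
  small-slack-in-Si : ∀ Δ i {B} → IsInverse (delRow i A) B → sumℕ (delRow i (slack A b z)) ≤ Δ ∸ 1 →
    InConv (SiPoints Δ B (delRow i b)) (ιv z)
  small-slack-in-Si Δ i {B} inv small = conv-SiPoints Δ B (delRow i b) (delRow i (slack A b z)) small λ k → begin
    ι (z k)                                                      ≡⟨ left-inverse i inv (ιv z) k ⟩
    sumℚ (λ r → B k r ℚ.* dot (delRow i A r) (ιv z))             ≡⟨ Σℚ.sum-cong (λ r → trans
                                                                      (cong (B k r ℚ.*_) (slack-≡ A b z z∈S (punchIn i r)))
                                                                      (expand (B k r) (β r) (σ r))) ⟩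
    sumℚ (λ r → B k r ℚ.* β r ℚ.+ (ℚ.- 1ℚ) ℚ.* (B k r ℚ.* σ r))  ≡⟨ Σℚ.sum-+ (λ r → B k r ℚ.* β r) (λ r → (ℚ.- 1ℚ) ℚ.* (B k r ℚ.* σ r)) ⟩
    u k ℚ.+ sumℚ (λ r → (ℚ.- 1ℚ) ℚ.* (B k r ℚ.* σ r))            ≡⟨ cong (u k ℚ.+_) (Σℚ.sum-* (ℚ.- 1ℚ) (λ r → B k r ℚ.* σ r)) ⟩
    u k ℚ.+ (ℚ.- 1ℚ) ℚ.* q k                                     ≡⟨ lem (u k) (q k) ⟩
    u k ℚ.+ ℚ.- q k                                              ∎
    where
    open ≡-Reasoning
    β σ u q : ℚVec n
    β r = ι (delRow i b r)
    σ r = ι (+ delRow i (slack A b z) r)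
    u   = mulMV B (delRow i b)
    q k = sumℚ (λ r → B k r ℚ.* σ r)
    expand : ∀ a p s → a ℚ.* (p ℚ.+ (ℚ.- 1ℚ) ℚ.* s) ≡ a ℚ.* p ℚ.+ (ℚ.- 1ℚ) ℚ.* (a ℚ.* s)
    expand = solve-∀ ℚ-ring
    lem : ∀ p s → p ℚ.+ (ℚ.- 1ℚ) ℚ.* s ≡ p ℚ.+ ℚ.- s
    lem = solve-∀ ℚ-ring

  -- `others≥0` supplies the off-diagonal signs of the matrix to be eliminated, `feasible` the
  -- points to be averaged.
  record Step (i : Fin (suc n)) : Set where
    field
      w        : ℤVec n
      nonzero  : ¬ (∀ k → w k ≡ 0ℤ)
      others≥0 : ∀ r → 0ℚ ℚ.≤ dot (delRow i A r) (ιv w)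
      feasible : InPoly A b (ιv (λ k → z k ℤ.+ w k))

  -- On the remaining rows the box keeps the increase within the slack; on row `i` boundedness makes
  -- the product with `w` negative, so any slack suffices there.
  step : ∀ i → Spanning (delRow i A) → ∣ det (delRow i A) ∣ ≤ sumℕ (delRow i (slack A b z)) → Step i
  step i sp large with lattice-vector-in-box (delRow i A) sp (delRow i (slack A b z)) large
  ... | w , w≢0 , box = record { w = w ; nonzero = w≢0 ; others≥0 = others ; feasible = feasible }
    where
    others : ∀ r → 0ℚ ℚ.≤ dot (delRow i A r) (ιv w)
    others r with box r
    ... | t , _ , eq = subst (0ℚ ℚ.≤_) (sym (trans (dot-ι (delRow i A) w r) (cong ι eq)))
      (ι-mono-≤ {0ℤ} {+ t} (ℤ.+≤+ z≤n))
    others-≤-slack : ∀ r → dot (delRow i A r) (ιv w) ℚ.≤ ι (+ delRow i (slack A b z) r)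
    others-≤-slack r with box r
    ... | t , t≤ , eq = subst (ℚ._≤ ι (+ delRow i (slack A b z) r))
      (sym (trans (dot-ι (delRow i A) w r) (cong ι eq))) (ι-mono-≤ {+ t} (ℤ.+≤+ t≤))
    row : ∀ j → dot (A j) (ιv w) ℚ.≤ ι (+ slack A b z j) → dot (A j) (ιv (λ k → z k ℤ.+ w k)) ℚ.≤ ι (b j)
    row j le = begin
      dot (A j) (ιv (λ k → z k ℤ.+ w k))                    ≡⟨ dot-cong (A j) (λ k → ι-+ (z k) (w k)) ⟩
      dot (A j) (λ k → ι (z k) ℚ.+ ι (w k))                 ≡⟨ dot-+ (A j) (ιv z) (ιv w) ⟩
      dot (A j) (ιv z) ℚ.+ dot (A j) (ιv w)                 ≤⟨ ℚ.+-monoʳ-≤ (dot (A j) (ιv z)) le ⟩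
      dot (A j) (ιv z) ℚ.+ s                                ≡⟨ cong (ℚ._+ s) (slack-≡ A b z z∈S j) ⟩
      ι (b j) ℚ.+ (ℚ.- 1ℚ) ℚ.* s ℚ.+ s                      ≡⟨ lem (ι (b j)) s ⟩
      ι (b j)                                               ∎
      where
      open ℚ.≤-Reasoning
      s : ℚ
      s = ι (+ slack A b z j)
      lem : ∀ p s → p ℚ.+ (ℚ.- 1ℚ) ℚ.* s ℚ.+ s ≡ p
      lem = solve-∀ ℚ-ring
    feasible : InPoly A b (ιv (λ k → z k ℤ.+ w k))
    feasible = punchIn-cover i
      (row i (ℚ.≤-trans (ℚ.<⇒≤ (remaining-row-negative i others (λ e → w≢0 (λ k → ι-injective (e k)))))
        (ι-mono-≤ {0ℤ} {+ slack A b z i} (ℤ.+≤+ z≤n))))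
      (λ r → row (punchIn i r) (others-≤-slack r))

  -- The weights `p`, rescaled to total 1, average the feasible points `z + w_i` to `z`. A vertex
  -- must equal each point of positive weight, which contradicts `w_i ≠ 0` at `i₀`.
  steps-not-vertex : (∀ i → Step i) → ∀ {v} → (∀ k → v k ≡ ι (z k)) → ¬ IsVertex (InIntHull A b) v
  steps-not-vertex steps {v} v≡z vertex with metzler-weights n M off
    where
    -- Rows are directions and columns are constraints, so combining the rows with weights `p` lists
    -- the values of `A` at `Σ p_i w_i`.
    M : Fin (suc n) → Fin (suc n) → ℚ
    M i j = dot (A j) (ιv (Step.w (steps i)))
    off : ∀ i j → i ≢ j → 0ℚ ℚ.≤ M i j
    off i j i≢j = subst (λ l → 0ℚ ℚ.≤ M i l) (Fin.punchIn-punchOut i≢j) (Step.others≥0 (steps i) (punchOut i≢j))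
  ... | p , p≥0 , (i₀ , 0<p₀) , sign = Step.nonzero (steps i₀) λ k → w≡0 k (vertex-point {A = A} {b} vertex z′ (Step.feasible ∘ steps)
        conv i₀ (*-positive 0<c 0<p₀) k)
    where
    open ≡-Reasoning
    w : Fin (suc n) → ℤVec n
    w i = Step.w (steps i)
    z′ : Fin (suc n) → ℤVec n
    z′ i k = z k ℤ.+ w i k
    balanced : ∀ k → sumℚ (λ i → p i ℚ.* ι (w i k)) ≡ 0ℚ
    balanced = [ (λ ≥0 → recession-≥ (λ j → subst (0ℚ ℚ.≤_) (sym (dot-sum (A j) p (ιv ∘ w))) (≥0 j)))
               , (λ ≤0 → recession-≤ (λ j → subst (ℚ._≤ 0ℚ) (sym (dot-sum (A j) p (ιv ∘ w))) (≤0 j))) ]′ sign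
    normaliser : ∃ λ c → 0ℚ ℚ.< c × c ℚ.* sumℚ p ≡ 1ℚ
    normaliser = reciprocal (ℚ.<-≤-trans 0<p₀ (sum-≥-term p≥0 i₀))
    c : ℚ
    c = proj₁ normaliser
    0<c : 0ℚ ℚ.< c
    0<c = proj₁ (proj₂ normaliser)
    c*Σp≡1 : c ℚ.* sumℚ p ≡ 1ℚ
    c*Σp≡1 = proj₂ (proj₂ normaliser)
    average : ∀ k → sumℚ (λ i → c ℚ.* p i ℚ.* ι (z′ i k)) ≡ v k
    average k = begin
      sumℚ (λ i → c ℚ.* p i ℚ.* ι (z′ i k))
        ≡⟨ Σℚ.sum-cong (λ i → trans (cong (c ℚ.* p i ℚ.*_) (ι-+ (z k) (w i k))) (expand c (p i) (ι (z k)) (ι (w i k)))) ⟩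
      sumℚ (λ i → c ℚ.* ι (z k) ℚ.* p i ℚ.+ c ℚ.* (p i ℚ.* ι (w i k)))
        ≡⟨ Σℚ.sum-+ (λ i → c ℚ.* ι (z k) ℚ.* p i) (λ i → c ℚ.* (p i ℚ.* ι (w i k))) ⟩
      sumℚ (λ i → c ℚ.* ι (z k) ℚ.* p i) ℚ.+ sumℚ (λ i → c ℚ.* (p i ℚ.* ι (w i k)))
        ≡⟨ cong₂ ℚ._+_ (Σℚ.sum-* (c ℚ.* ι (z k)) p) (trans (Σℚ.sum-* c (λ i → p i ℚ.* ι (w i k))) (cong (c ℚ.*_) (balanced k))) ⟩
      c ℚ.* ι (z k) ℚ.* sumℚ p ℚ.+ c ℚ.* 0ℚ
        ≡⟨ collect c (ι (z k)) (sumℚ p) ⟩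
      c ℚ.* sumℚ p ℚ.* ι (z k)
        ≡⟨ trans (cong (ℚ._* ι (z k)) c*Σp≡1) (ℚ.*-identityˡ (ι (z k))) ⟩
      ι (z k)
        ≡⟨ sym (v≡z k) ⟩
      v k ∎
      where
      expand : ∀ c p x y → c ℚ.* p ℚ.* (x ℚ.+ y) ≡ c ℚ.* x ℚ.* p ℚ.+ c ℚ.* (p ℚ.* y)
      expand = solve-∀ ℚ-ring
      collect : ∀ c x s → c ℚ.* x ℚ.* s ℚ.+ c ℚ.* 0ℚ ≡ c ℚ.* s ℚ.* x
      collect = solve-∀ ℚ-ring
    conv : InConv (λ i → ιv (z′ i)) v
    conv = (λ i → c ℚ.* p i) , (λ i → *-nonneg (ℚ.<⇒≤ 0<c) (p≥0 i)) , trans (Σℚ.sum-* c p) c*Σp≡1 , sym ∘ average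
    w≡0 : ∀ k → ι (z′ i₀ k) ≡ v k → w i₀ k ≡ 0ℤ
    w≡0 k e = trans (lem (z k) (w i₀ k)) (trans (cong (ℤ._+ ℤ.- z k) (ι-injective {z k ℤ.+ w i₀ k} {z k} (trans e (v≡z k)))) (ℤ.+-inverseʳ (z k)))
      where
      lem : ∀ x y → y ≡ (x ℤ.+ y) ℤ.+ ℤ.- x
      lem = ℤ-Ring.solve-∀

-- Locating the vertices in the simplices `S_i`

theorem7 : (n Δ : ℕ) → 1 ≤ Δ →
    (A : Fin (suc n) → Fin n → ℤ) → (b : Fin (suc n) → ℤ) →
    FullDimSimplex A b →
    SubdetBound A Δ →
    MinFacetWidthAtLeast A b (ι (+ (Δ ∸ 1))) →
    (Ainv : Fin (suc n) → Fin n → Fin n → ℚ) →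
    (∀ i → IsInverse (delRow i A) (Ainv i)) →
    (v : ℚVec n) → IsVertex (InIntHull A b) v →
    Σ (ℤVec n) λ z → (∀ k → v k ≡ ι (z k)) × InV Δ b Ainv z
theorem7 n (suc D) _ A b (_ , bounded) subdet _ Ainv inv v vertex@((k , z , z∈S , conv@(λs , _ , Σλs≡1 , _)) , _)
  -- Convex weights sum to 1, so one is positive, and the vertex coincides with the integral point
  -- carrying it.
  with positive-term λs (subst (0ℚ ℚ.<_) (sym Σλs≡1) 0<1)
... | t , 0<λt = z t , v≡z , located
  where
  open IntegerPoint A b bounded (z t) (z∈S t)
  v≡z : ∀ c → v c ≡ ι (z t c)
  v≡z c = sym (vertex-point {A = A} {b} vertex z z∈S conv t 0<λt c)
  located : InV (suc D) b Ainv (z t)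
  located with Fin.any? (λ i → sumℕ (delRow i (slack A b (z t))) ℕ.≤? D)
  ... | yes (i , small) = i , small-slack-in-Si (suc D) i (inv i) small
  -- A slack sum exceeding `D` is at least `suc D`, the bound on `∣ det A_i ∣`, so a step exists for
  -- every `i`.
  ... | no  none = contradiction vertex (steps-not-vertex
    (λ i → step i (inverse-spanning {M = delRow i A} {Ainv i} (inv i))
      (ℕ.≤-trans (subdet (punchIn i) (Fin.punchIn-injective i _ _)) (ℕ.≰⇒> (λ small → none (i , small))))) v≡z)
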